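{- Let $p\geq 3$ be a prime and $H_p$ the Heisenberg group over $\mathbb Z_p$ (presented as $\{x^ay^bz^c:0\le a,b,c<p\}$ with $x^p=y^p=z^p=1$, $xz=zx$, $yz=zy$, $yx=xyz$). For any $a\in\mathbb N$ with $p\nmid a$ and any $m\in\mathbb Z$ there is $F=\sum_{0\le i,j,k<p}a_{ijk}x^iy^jz^k$ with $a_{ijk}\in\mathbb Z$ such that $M_{H_p}(F)=a^{p^2}+mp^3$.
   Context: $M_{H_p}(F)=\det(a_{gh^{ -1}})_{g,h\in H_p}$ is the group determinant of $H_p$ evaluated at the coefficients of $F$, where $a_g=a_{ijk}$ for $g=x^iy^jz^k$. -}

module Defs where

open import Data.Nat as ℕ using (ℕ; zero; suc; NonZero)
open import Data.Integer using (ℤ; +_; -_; _+_; _-_; _*_; _%ℕ_)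
open import Data.Integer.DivMod using (n%ℕd<d)
open import Data.Fin using (Fin; zero; suc; toℕ; fromℕ<; punchIn; remQuot)
open import Data.List using (List; foldr; map)
open import Data.List using () renaming (allFin to allFinL)
open import Data.Product using (_×_; _,_)

∑ : ∀ {n} → (Fin n → ℤ) → ℤ
∑ {n} f = foldr _+_ (+ 0) (map f (allFinL n))

sgn : ℕ → ℤ
sgn zero = + 1
sgn (suc k) = - sgn k

det : ∀ {n} → (Fin n → Fin n → ℤ) → ℤ
det {zero} M = + 1
det {suc n} M = ∑ λ j → sgn (toℕ j) * M zero j * det (λ r c → M (suc r) (punchIn j c))

modP : (p : ℕ) .{{_ : NonZero p}} → ℤ → Fin p
modP p z = fromℕ< (n%ℕd<d z p)

-- Elements of the Heisenberg group H_p: x^a y^b z^c  ↦  (a , b , c).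
Hp : ℕ → Set
Hp p = Fin p × Fin p × Fin p

-- Multiplication: x^a y^b z^c · x^d y^e z^f = x^(a+d) y^(b+e) z^(c+f+bd)   (yx = xyz)
mulH : (p : ℕ) .{{_ : NonZero p}} → Hp p → Hp p → Hp p
mulH p (a , b , c) (d , e , f) =
  modP p (+ toℕ a + + toℕ d) , modP p (+ toℕ b + + toℕ e) ,
  modP p (+ toℕ c + + toℕ f + + toℕ b * + toℕ d)

invH : (p : ℕ) .{{_ : NonZero p}} → Hp p → Hp p
invH p (a , b , c) =
  modP p (- + toℕ a) , modP p (- + toℕ b) , modP p (+ toℕ a * + toℕ b - + toℕ c)

elemH : (p : ℕ) → Fin (p ℕ.* p ℕ.* p) → Hp p
elemH p i with remQuot {p ℕ.* p} p i
... | (ab , c) with remQuot {p} p ab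
... | (a , b) = a , b , c

-- Group determinant M_{H_p}(F) = det (a_{g h^{-1}})_{g,h ∈ H_p},
-- where F = ∑ a_{ijk} x^i y^j z^k is given by its coefficient function.
groupDet : (p : ℕ) .{{_ : NonZero p}} → (Fin p → Fin p → Fin p → ℤ) → ℤ
groupDet p F = det λ i j → coeff (mulH p (elemH p i) (invH p (elemH p j)))
  where
  coeff : Hp p → ℤ
  coeff (a , b , c) = F a b c

{-# OPTIONS --safe #-}

-- Let u = 1 + t + ⋯ + t^(a-1) in ℤ[ℤ/p], with p × p circulant C: it has row sums a and, since p ∤ a,
-- determinant a.  If B is any matrix and J denotes an all-ones matrix, then
-- det (I ⊗ C + B ⊗ J) = det (aI + pB), because J lives on the eigenvalue a of C.
-- In ℤ[H_p] the element F = u(z) + (1 + z + ⋯ + z^(p-1)) h(x, y) has such a matrix, with B the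
-- (ℤ/p)²-matrix of h, so it suffices to realise a^(p²) + mp³ as det (aI + pB).
-- By the Frobenius congruence C^p = aI + pB′, so the (ℤ/p)²-matrix G = I ⊗ C + B′ ⊗ J has
-- determinant det (C^p) = a^p, and row sums a^p as well.  By Frobenius again and a^p ≡ a,
-- G^p = aI + pB₀, with determinant and row sums a^(p²).  Finally B = B₀ + mJ changes
-- det (aI + pB₀) by the factor 1 + mp³ / a^(p²).

module Submission where

open import Defs
open import Algebra.Bundles using (Semiring; module CommutativeSemiring)
open import Algebra.Structures using (IsAbelianGroup)
import Algebra.Properties.CommutativeMonoid.Mult as CommutativeMonoidMult
import Algebra.Properties.Semiring.Binomial as SemiringBinomial
import Algebra.Properties.Semiring.Exp as SemiringExp
import Algebra.Properties.Semiring.Mult as SemiringMult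
import Algebra.Properties.Semiring.Sum as SemiringSum
open import Data.Fin using (Fin; zero; suc; toℕ; fromℕ; inject₁; punchIn; punchOut; splitAt; _↑ˡ_; remQuot; combine)
import Data.Fin as Fin
import Data.Fin.Permutation as Permutation
import Data.Fin.Properties as Fin
open import Data.Integer using (ℤ; +_; -[1+_]; _+_; _*_; _^_; _-_; -_; ∣_∣; _%ℕ_; _/ℕ_)
import Data.Integer as ℤ
import Data.Integer.Properties as ℤ
open import Data.Integer.DivMod using (n%ℕd<d; a≡a%ℕn+[a/ℕn]*n)
import Data.Integer.Divisibility.Signed as Signed
open import Data.Integer.Tactic.RingSolver using (solve-∀)
open import Data.List using (foldr)
import Data.List.Properties as List
open import Data.Nat using (ℕ; zero; suc; NonZero; _≤_; _<_; _∸_; _!)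
import Data.Nat as ℕ
import Data.Nat.Properties as ℕ
open import Data.Nat.Combinatorics using (nCn≡1; nCk≡n!/k![n-k]!; k![n∸k]!∣n!) renaming (_C_ to _choose_)
open import Data.Nat.Divisibility using (_∣_)
import Data.Nat.Divisibility as ℕ
open import Data.Nat.DivMod using (m/n*n≡m)
open import Data.Nat.Primality using (Prime; euclidsLemma; prime⇒nonTrivial)
open import Data.Product using (Σ; ∃; _×_; _,_; proj₁; proj₂)
open import Data.Sum using (_⊎_; inj₁; inj₂)
open import Data.Vec.Functional using (_∷_; insertAt)
open import Function using (_∘_; id)
open import Level using (0ℓ)
open import Relation.Binary.PropositionalEquality hiding (J)
open import Relation.Nullary using (¬_; yes; no; contradiction)

-- The target is additive in `m`, whereas adding c times `J` to an n × n matrix K with row sums s ≠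
-- 0 multiplies its determinant by 1 + nc/s. The change is exactly nc when det K = s, so the base
-- matrix is sought among matrices whose determinant equals their row sum. The circulant C has both
-- equal to a, p-th powers preserve the coincidence, and so does the passage from C^p on p points to
-- G on p² points. With n = p² the choice c = pm gives mp³. Noncommutativity is harmless because
-- h(x, y) is multiplied by the sum of all powers of the central element z, which absorbs every
-- commutator, while u(z) is itself central. All identities stay in ℤ: a formula with a quotient is
-- multiplied out, and the nonzero factor is cancelled afterwards. As `det` is the Laplace expansion
-- along the first row, its multiplicativity, transposition and block rules are derived from the
-- uniqueness of alternating functions of the rows.

private
  ℤ-semiring : Semiring 0ℓ 0ℓ
  ℤ-semiring = CommutativeSemiring.semiring ℤ.+-*-commutativeSemiring

open SemiringSum ℤ-semiring
  using (sum; sum-cong-≗; ∑-distrib-+; ∑-comm; *-distribˡ-sum; *-distribʳ-sum; sum-replicate-zero; sum-init-last)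

-- Finite sums and matrices

∑-suc : ∀ {n} (f : Fin (suc n) → ℤ) → ∑ f ≡ f zero + ∑ (f ∘ suc)
∑-suc {n} f = cong (λ l → f zero + foldr _+_ (+ 0) l)
  (trans (List.map-tabulate suc f) (sym (List.map-tabulate id (f ∘ suc))))

∑≡sum : ∀ {n} (f : Fin n → ℤ) → ∑ f ≡ sum f
∑≡sum {zero}  f = refl
∑≡sum {suc n} f = trans (∑-suc f) (cong (_+_ (f zero)) (∑≡sum (f ∘ suc)))

sum-zero : ∀ {n} {f : Fin n → ℤ} → (∀ i → f i ≡ + 0) → sum f ≡ + 0
sum-zero {n} h = trans (sum-cong-≗ h) (sum-replicate-zero n)

sum-linear : ∀ {n} a (f g : Fin n → ℤ) → sum (λ i → a * f i + g i) ≡ a * sum f + sum g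
sum-linear a f g = trans (∑-distrib-+ (λ i → a * f i) g) (cong (_+ sum g) (sym (*-distribˡ-sum a f)))

sum-single : ∀ {n} (j : Fin n) {f : Fin n → ℤ} → (∀ i → i ≢ j → f i ≡ + 0) → sum f ≡ f j
sum-single zero    {f} h = trans (cong (_+_ (f zero)) (sum-zero λ i → h (suc i) λ ())) (ℤ.+-identityʳ _)
sum-single (suc j) {f} h = trans (cong₂ _+_ (h zero λ ()) (sum-single j λ i i≢j → h (suc i) (i≢j ∘ Fin.suc-injective)))
                                 (ℤ.+-identityˡ _)

-- For expansions along a column of a matrix with two equal consecutive rows, where only the terms
-- of these two rows survive.
sum-adjacent : ∀ {n} (i k : Fin n) → toℕ k ≡ suc (toℕ i) → {f : Fin n → ℤ} →
               (∀ j → j ≢ i → j ≢ k → f j ≡ + 0) → sum f ≡ f i + f k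
sum-adjacent zero    (suc zero) _ {f} h =
  cong (_+_ (f zero)) (sum-single zero λ j j≢0 → h (suc j) (λ ()) (j≢0 ∘ Fin.suc-injective))
sum-adjacent (suc i) (suc k) e {f} h =
  trans (cong₂ _+_ (h zero (λ ()) (λ ()))
          (sum-adjacent i k (ℕ.suc-injective e)
            λ j p q → h (suc j) (p ∘ Fin.suc-injective) (q ∘ Fin.suc-injective)))
        (ℤ.+-identityˡ _)

sum-splitAt : ∀ m {n} (f : Fin m ⊎ Fin n → ℤ) →
              sum (λ k → f (splitAt m k)) ≡ sum (f ∘ inj₁) + sum (f ∘ inj₂)
sum-splitAt zero    f = sym (ℤ.+-identityˡ _)
sum-splitAt (suc m) {n} f = begin
  f (inj₁ zero) + sum (λ k → f (splitAt (suc m) (suc k)))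
    ≡⟨ cong (_+_ (f (inj₁ zero))) (sum-cong-≗ {n = m ℕ.+ n} λ k → cong f (step k)) ⟩
  f (inj₁ zero) + sum (λ k → f (shift (splitAt m k)))
    ≡⟨ cong (_+_ (f (inj₁ zero))) (sum-splitAt m (f ∘ shift)) ⟩
  f (inj₁ zero) + (sum (f ∘ inj₁ ∘ suc) + sum (f ∘ inj₂))
    ≡⟨ ℤ.+-assoc (f (inj₁ zero)) _ _ ⟨
  sum (f ∘ inj₁) + sum (f ∘ inj₂) ∎
  where
  open ≡-Reasoning
  shift : Fin m ⊎ Fin n → Fin (suc m) ⊎ Fin n
  shift (inj₁ i) = inj₁ (suc i)
  shift (inj₂ j) = inj₂ j
  step : ∀ k → splitAt (suc m) (suc k) ≡ shift (splitAt m k)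
  step k with splitAt m k
  ... | inj₁ _ = refl
  ... | inj₂ _ = refl

Matrix : ℕ → ℕ → Set
Matrix m n = Fin m → Fin n → ℤ

infix 4 _≈_
_≈_ : ∀ {m n} → Matrix m n → Matrix m n → Set
M ≈ N = ∀ i j → M i j ≡ N i j

≈-sym : ∀ {m n} {M N : Matrix m n} → M ≈ N → N ≈ M
≈-sym h i j = sym (h i j)

≈-trans : ∀ {m n} {M N P : Matrix m n} → M ≈ N → N ≈ P → M ≈ P
≈-trans h k i j = trans (h i j) (k i j)

_ᵀ : ∀ {m n} → Matrix m n → Matrix n m
(M ᵀ) i j = M j i

δ : ∀ {n} → Matrix n n
δ zero    zero    = + 1
δ zero    (suc j) = + 0
δ (suc i) zero    = + 0
δ (suc i) (suc j) = δ i j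

δ-refl : ∀ {n} (i : Fin n) → δ i i ≡ + 1
δ-refl zero    = refl
δ-refl (suc i) = δ-refl i

δ-≢ : ∀ {n} {i j : Fin n} → i ≢ j → δ i j ≡ + 0
δ-≢ {i = zero}  {zero}  h = contradiction refl h
δ-≢ {i = zero}  {suc j} h = refl
δ-≢ {i = suc i} {zero}  h = refl
δ-≢ {i = suc i} {suc j} h = δ-≢ (h ∘ cong suc)

δ-sym : ∀ {n} (i j : Fin n) → δ i j ≡ δ j i
δ-sym zero    zero    = refl
δ-sym zero    (suc j) = refl
δ-sym (suc i) zero    = refl
δ-sym (suc i) (suc j) = δ-sym i j

δ-cong-⇔ : ∀ {m n} {i j : Fin m} {k l : Fin n} → (i ≡ j → k ≡ l) → (k ≡ l → i ≡ j) → δ i j ≡ δ k l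
δ-cong-⇔ {i = i} {j} {k} {l} f g with i Fin.≟ j
... | yes refl rewrite f refl = trans (δ-refl i) (sym (δ-refl l))
... | no i≢j = trans (δ-≢ i≢j) (sym (δ-≢ (i≢j ∘ g)))

sum-δˡ : ∀ {n} (i : Fin n) (f : Fin n → ℤ) → sum (λ k → δ i k * f k) ≡ f i
sum-δˡ i f = trans (sum-single i λ k k≢i → cong (_* f k) (δ-≢ (k≢i ∘ sym)))
                   (trans (cong (_* f i) (δ-refl i)) (ℤ.*-identityˡ _))

sum-δʳ : ∀ {n} (j : Fin n) (f : Fin n → ℤ) → sum (λ k → f k * δ k j) ≡ f j
sum-δʳ j f = trans (sum-cong-≗ λ k → trans (ℤ.*-comm (f k) _) (cong (_* f k) (δ-sym k j))) (sum-δˡ j f)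

infixl 7 _·_
_·_ : ∀ {l m n} → Matrix l m → Matrix m n → Matrix l n
(M · N) i j = sum λ k → M i k * N k j

·-cong : ∀ {l m n} {M M′ : Matrix l m} {N N′ : Matrix m n} → M ≈ M′ → N ≈ N′ → M · N ≈ M′ · N′
·-cong h k i j = sum-cong-≗ λ l → cong₂ _*_ (h i l) (k l j)

·-identityˡ : ∀ {m n} (M : Matrix m n) → δ · M ≈ M
·-identityˡ M i j = sum-δˡ i (λ k → M k j)

·-identityʳ : ∀ {m n} (M : Matrix m n) → M · δ ≈ M
·-identityʳ M i j = sum-δʳ j (M i)

·-assoc : ∀ {k l m n} (A : Matrix k l) (B : Matrix l m) (C : Matrix m n) → (A · B) · C ≈ A · (B · C)
·-assoc A B C i j = begin
  sum (λ s → sum (λ r → A i r * B r s) * C s j)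
    ≡⟨ sum-cong-≗ (λ s → *-distribʳ-sum (C s j) (λ r → A i r * B r s)) ⟩
  sum (λ s → sum (λ r → A i r * B r s * C s j))
    ≡⟨ ∑-comm (λ s r → A i r * B r s * C s j) ⟩
  sum (λ r → sum (λ s → A i r * B r s * C s j))
    ≡⟨ sum-cong-≗ (λ r → trans (sum-cong-≗ (λ s → ℤ.*-assoc (A i r) (B r s) (C s j)))
         (sym (*-distribˡ-sum (A i r) (λ s → B r s * C s j)))) ⟩
  sum (λ r → A i r * sum (λ s → B r s * C s j)) ∎
  where open ≡-Reasoning

-- Determinants

minor : ∀ {n} → Fin (suc n) → Matrix (suc n) (suc n) → Matrix n n
minor j M r c = M (suc r) (punchIn j c)

det-suc : ∀ {n} (M : Matrix (suc n) (suc n)) →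
          det M ≡ sum λ j → sgn (toℕ j) * M zero j * det (minor j M)
det-suc M = ∑≡sum λ j → sgn (toℕ j) * M zero j * det (minor j M)

det-cong : ∀ {n} {M N : Matrix n n} → M ≈ N → det M ≡ det N
det-cong {zero}  h = refl
det-cong {suc n} {M} {N} h = trans (det-suc M) (trans
  (sum-cong-≗ λ j → cong₂ (λ a b → sgn (toℕ j) * a * b) (h zero j) (det-cong λ r c → h (suc r) (punchIn j c)))
  (sym (det-suc N)))

-- Vanishing is demanded only for consecutive equal rows, since this is what an expansion yields
-- directly; `repeated` extends it to all pairs. Linearity is a relation between three matrices that
-- agree off row `i`, so no row-update operation is needed. `congr` stands in for function
-- extensionality.
record Alternating {m n} (f : Matrix m n → ℤ) : Set where
  field
    linear   : ∀ i a (M U V : Matrix m n) → (∀ j → M i j ≡ a * U i j + V i j) →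
               (∀ k → k ≢ i → ∀ j → M k j ≡ U k j) → (∀ k → k ≢ i → ∀ j → M k j ≡ V k j) →
               f M ≡ a * f U + f V
    adjacent : ∀ (i k : Fin m) → toℕ k ≡ suc (toℕ i) → ∀ M → (∀ j → M i j ≡ M k j) → f M ≡ + 0
    congr    : ∀ {M N} → M ≈ N → f M ≡ f N

open Alternating

self-sum-zero : ∀ {x : ℤ} → x ≡ x + x → x ≡ + 0
self-sum-zero {x} h = begin
  x             ≡⟨ cancel x ⟩
  x + x - x     ≡⟨ cong (_- x) h ⟨
  x - x         ≡⟨ ℤ.+-inverseʳ x ⟩
  + 0           ∎
  where
  open ≡-Reasoning
  cancel : ∀ x → x ≡ x + x - x
  cancel = solve-∀

module _ {m n} {f : Matrix m n → ℤ} (F : Alternating f) where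

  -- A zero row is once itself plus itself, so linearity gives `f M ≡ f M + f M`.
  vanishes-zero : ∀ i M → (∀ j → M i j ≡ + 0) → f M ≡ + 0
  vanishes-zero i M h = self-sum-zero (trans
    (linear F i (+ 1) M M M (λ j → trans (h j) (cong (λ z → + 1 * z + z) (sym (h j))))
      (λ _ _ _ → refl) (λ _ _ _ → refl))
    (cong (_+ f M) (ℤ.*-identityˡ (f M))))

∷-η : ∀ {m n} (M : Matrix (suc m) n) → M ≈ M zero ∷ (M ∘ suc)
∷-η M zero    j = refl
∷-η M (suc i) j = refl

∷-cong : ∀ {m n} {u v : Fin n → ℤ} {M N : Matrix m n} → (∀ j → u j ≡ v j) → M ≈ N → u ∷ M ≈ v ∷ N
∷-cong h k zero    j = h j
∷-cong h k (suc i) j = k i j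

module _ {m n} {f : Matrix (suc m) n → ℤ} (F : Alternating f) where

  -- The inductions below peel off rows one at a time; for this reason `Alternating` is stated for
  -- rectangular matrices.
  ∷-alternating : ∀ u → Alternating (λ R → f (u ∷ R))
  ∷-alternating u .linear i a M U V h hU hV = linear F (suc i) a (u ∷ M) (u ∷ U) (u ∷ V) h
    (λ { zero _ j → refl; (suc k) k≢i j → hU k (k≢i ∘ cong suc) j })
    (λ { zero _ j → refl; (suc k) k≢i j → hV k (k≢i ∘ cong suc) j })
  ∷-alternating u .adjacent i k e M h = adjacent F (suc i) (suc k) (cong suc e) (u ∷ M) h
  ∷-alternating u .congr h = congr F (∷-cong (λ _ → refl) h)

  ∷-linear : ∀ a {u v w : Fin n → ℤ} R → (∀ j → w j ≡ a * u j + v j) →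
             f (w ∷ R) ≡ a * f (u ∷ R) + f (v ∷ R)
  ∷-linear a R h = linear F zero a _ _ _ h
    (λ { zero 0≢0 → contradiction refl 0≢0; (suc k) _ _ → refl })
    (λ { zero 0≢0 → contradiction refl 0≢0; (suc k) _ _ → refl })

  ∷-sum : ∀ {s} (c : Fin s → ℤ) (w : Matrix s n) R →
          f ((λ j → sum λ k → c k * w k j) ∷ R) ≡ sum λ k → c k * f (w k ∷ R)
  ∷-sum {zero}  c w R = vanishes-zero F zero _ (λ _ → refl)
  ∷-sum {suc s} c w R = trans (∷-linear (c zero) R (λ _ → refl))
    (cong (_+_ (c zero * f (w zero ∷ R))) (∷-sum (c ∘ suc) (w ∘ suc) R))

  expand-head : ∀ u R → f (u ∷ R) ≡ sum λ j → u j * f (δ j ∷ R)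
  expand-head u R = trans (congr F (∷-cong (λ j → sym (sum-δʳ j u)) (λ _ _ → refl))) (∷-sum u δ R)

-- Polarisation: expand f at two equal rows `w`, the sum of `u` and `v`; the two terms with a
-- repeated row vanish and the two mixed ones add up to zero.
swap-head : ∀ {m n} {f : Matrix (suc (suc m)) n → ℤ} → Alternating f →
            ∀ u v R → f (u ∷ v ∷ R) ≡ - f (v ∷ u ∷ R)
swap-head {f = f} F u v R = begin
  x          ≡⟨ add-sub x y ⟩
  x + y - y  ≡⟨ cong (_- y) x+y≡0 ⟩
  + 0 - y    ≡⟨ ℤ.+-identityˡ (- y) ⟩
  - y        ∎
  where
  open ≡-Reasoning
  w = λ j → + 1 * u j + v j
  x = f (u ∷ v ∷ R)
  y = f (v ∷ u ∷ R)
  add-sub : ∀ x y → x ≡ x + y - y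
  add-sub = solve-∀
  double : ∀ t → f (t ∷ t ∷ R) ≡ + 0
  double t = adjacent F zero (suc zero) refl _ (λ _ → refl)
  collect : ∀ x y → + 1 * (+ 1 * (+ 0) + x) + (+ 1 * y + + 0) ≡ x + y
  collect = solve-∀
  expand : ∀ t → f (t ∷ w ∷ R) ≡ + 1 * f (t ∷ u ∷ R) + f (t ∷ v ∷ R)
  expand t = ∷-linear (∷-alternating F t) (+ 1) R (λ _ → refl)
  x+y≡0 : x + y ≡ + 0
  x+y≡0 = begin
    x + y                                             ≡⟨ collect x y ⟨
    + 1 * (+ 1 * (+ 0) + x) + (+ 1 * y + + 0)
      ≡⟨ cong₂ (λ s t → + 1 * (+ 1 * s + x) + (+ 1 * y + t)) (double u) (double v) ⟨
    + 1 * (+ 1 * f (u ∷ u ∷ R) + x) + (+ 1 * y + f (v ∷ v ∷ R))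
      ≡⟨ cong₂ (λ s t → + 1 * s + t) (expand u) (expand v) ⟨
    + 1 * f (u ∷ w ∷ R) + f (v ∷ w ∷ R)               ≡⟨ ∷-linear F (+ 1) (w ∷ R) (λ _ → refl) ⟨
    f (w ∷ w ∷ R)                                     ≡⟨ double w ⟩
    + 0                                               ∎

-- Swapping the two top rows moves row zero one step closer to its copy; the new head is then fixed
-- and the induction runs on the distance.
repeated-head : ∀ {m n} {f : Matrix (suc m) n → ℤ} → Alternating f →
                ∀ k M → (∀ j → M zero j ≡ M (suc k) j) → f M ≡ + 0
repeated-head F zero    M h = adjacent F zero (suc zero) refl M h
repeated-head {f = f} F (suc k) M h = begin
  f M                                            ≡⟨ congr F (∷-η M) ⟩
  f (M zero ∷ (M ∘ suc))                         ≡⟨ congr F (∷-cong (λ _ → refl) (∷-η (M ∘ suc))) ⟩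
  f (M zero ∷ M (suc zero) ∷ ((M ∘ suc) ∘ suc))    ≡⟨ swap-head F _ _ _ ⟩
  - f (M (suc zero) ∷ M zero ∷ ((M ∘ suc) ∘ suc))
    ≡⟨ cong -_ (repeated-head (∷-alternating F (M (suc zero))) k (M zero ∷ ((M ∘ suc) ∘ suc)) h) ⟩
  + 0                                            ∎
  where open ≡-Reasoning

repeated : ∀ {m n} {f : Matrix m n → ℤ} → Alternating f →
           ∀ i k → i ≢ k → ∀ M → (∀ j → M i j ≡ M k j) → f M ≡ + 0
repeated F zero    zero    i≢k M h = contradiction refl i≢k
repeated F zero    (suc k) i≢k M h = repeated-head F k M h
repeated F (suc i) zero    i≢k M h = repeated-head F i M (sym ∘ h)
repeated F (suc i) (suc k) i≢k M h = trans (congr F (∷-η M))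
  (repeated (∷-alternating F (M zero)) i k (i≢k ∘ cong suc) (M ∘ suc) h)

clear-multiples : ∀ {m n} {f : Matrix m n → ℤ} → Alternating f → (e : Fin n → ℤ) →
                  (∀ i M → (∀ j → M i j ≡ e j) → f M ≡ + 0) →
                  ∀ (a : Fin m → ℤ) M N → (∀ i j → M i j ≡ a i * e j + N i j) → f M ≡ f N
clear-multiples {zero}  F e v a M N h = congr F λ ()
clear-multiples {suc m} {f = f} F e v a M N h = begin
  f M                                                  ≡⟨ congr F (∷-η M) ⟩
  f (M zero ∷ (M ∘ suc))                               ≡⟨ ∷-linear F (a zero) (M ∘ suc) (h zero) ⟩
  a zero * f (e ∷ (M ∘ suc)) + f (N zero ∷ (M ∘ suc))
    ≡⟨ cong (λ z → a zero * z + f (N zero ∷ (M ∘ suc))) (v zero _ λ _ → refl) ⟩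
  a zero * (+ 0) + f (N zero ∷ (M ∘ suc))              ≡⟨ drop (a zero) _ ⟩
  f (N zero ∷ (M ∘ suc))
    ≡⟨ clear-multiples (∷-alternating F (N zero)) e (λ i M′ → v (suc i) (N zero ∷ M′))
         (a ∘ suc) (M ∘ suc) (N ∘ suc) (h ∘ suc) ⟩
  f (N zero ∷ (N ∘ suc))                               ≡⟨ congr F (∷-η N) ⟨
  f N                                                  ∎
  where
  open ≡-Reasoning
  drop : ∀ a x → a * (+ 0) + x ≡ x
  drop = solve-∀

insertAt-linear : ∀ {n} i a {u v w : Fin n → ℤ} → (∀ j → w j ≡ a * u j + v j) →
                  ∀ j → insertAt w i (+ 0) j ≡ a * insertAt u i (+ 0) j + insertAt v i (+ 0) j
insertAt-linear zero    a h zero    = sym (trans (ℤ.+-identityʳ _) (ℤ.*-zeroʳ a))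
insertAt-linear zero    a h (suc j) = h j
insertAt-linear {suc n} (suc i) a h zero    = h zero
insertAt-linear {suc n} (suc i) a h (suc j) = insertAt-linear i a (h ∘ suc) j

insertAt-cong : ∀ {n} i {u v : Fin n → ℤ} → (∀ j → u j ≡ v j) →
                ∀ j → insertAt u i (+ 0) j ≡ insertAt v i (+ 0) j
insertAt-cong zero    h zero    = refl
insertAt-cong zero    h (suc j) = h j
insertAt-cong {suc n} (suc i) h zero    = h zero
insertAt-cong {suc n} (suc i) h (suc j) = insertAt-cong i (h ∘ suc) j

-- The remainder is `u` with entry `i` replaced by zero, written with `insertAt` so that after
-- clearing a column only the minor is left.
split-entry : ∀ {n} (i : Fin (suc n)) (u : Fin (suc n) → ℤ) →
              ∀ j → u j ≡ u i * δ i j + insertAt (u ∘ punchIn i) i (+ 0) j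
split-entry zero    u zero    = keep (u zero)
  where
  keep : ∀ x → x ≡ x * (+ 1) + + 0
  keep = solve-∀
split-entry zero    u (suc j) = drop (u zero) (u (suc j))
  where
  drop : ∀ a x → x ≡ a * (+ 0) + x
  drop = solve-∀
split-entry {suc n} (suc i) u zero    = drop (u (suc i)) (u zero)
  where
  drop : ∀ a x → x ≡ a * (+ 0) + x
  drop = solve-∀
split-entry {suc n} (suc i) u (suc j) = split-entry i (u ∘ suc) j

-- Embeds smaller matrices as the complement of row zero and column `j`, which makes the induction
-- hypothesis of `det-unique` applicable to minors.
insert-alternating : ∀ {m n} {f : Matrix (suc m) (suc n) → ℤ} → Alternating f →
                     ∀ j → Alternating (λ N → f (δ j ∷ λ r → insertAt (N r) j (+ 0)))
insert-alternating F j .linear i a M U V h hU hV =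
  linear (∷-alternating F (δ j)) i a _ _ _ (insertAt-linear j a h)
    (λ k k≢i → insertAt-cong j (hU k k≢i)) (λ k k≢i → insertAt-cong j (hV k k≢i))
insert-alternating F j .adjacent i k e M h =
  adjacent (∷-alternating F (δ j)) i k e _ (insertAt-cong j h)
insert-alternating F j .congr h = congr (∷-alternating F (δ j)) (λ i → insertAt-cong j (h i))

δ-∷ : ∀ {n} → δ zero ∷ (λ r → insertAt (δ r) zero (+ 0)) ≈ δ {suc n}
δ-∷ zero    j       = refl
δ-∷ (suc i) zero    = refl
δ-∷ (suc i) (suc j) = refl

-- The argument of f is the permutation matrix of a cycle on the first j + 1 indices. One swap of
-- the two top rows puts the unit row `δ zero` on top, and the cycle that remains below it is
-- shorter by one.
cycle-sign : ∀ {n} {f : Matrix (suc n) (suc n) → ℤ} → Alternating f →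
             ∀ j → f (δ j ∷ λ r → insertAt (δ r) j (+ 0)) ≡ sgn (toℕ j) * f δ
cycle-sign {n} {f} F zero = trans (congr F δ-∷) (sym (ℤ.*-identityˡ (f δ)))
cycle-sign {suc n} {f} F (suc j) = begin
  f (δ (suc j) ∷ λ r → insertAt (δ r) (suc j) (+ 0))
    ≡⟨ congr F (∷-cong (λ _ → refl) unfold) ⟩
  f (δ (suc j) ∷ δ zero ∷ λ r → insertAt (insertAt (δ r) j (+ 0)) zero (+ 0))
    ≡⟨ swap-head F _ _ _ ⟩
  - f (δ zero ∷ δ (suc j) ∷ λ r → insertAt (insertAt (δ r) j (+ 0)) zero (+ 0))
    ≡⟨ cong -_ (congr F (∷-cong (λ _ → refl) fold)) ⟩
  - f (δ zero ∷ λ r → insertAt ((δ j ∷ λ r → insertAt (δ r) j (+ 0)) r) zero (+ 0))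
    ≡⟨ cong -_ (cycle-sign (insert-alternating F zero) j) ⟩
  - (sgn (toℕ j) * f (δ zero ∷ λ r → insertAt (δ r) zero (+ 0)))
    ≡⟨ ℤ.neg-distribˡ-* (sgn (toℕ j)) _ ⟩
  - sgn (toℕ j) * f (δ zero ∷ λ r → insertAt (δ r) zero (+ 0))
    ≡⟨ cong (- sgn (toℕ j) *_) (congr F δ-∷) ⟩
  - sgn (toℕ j) * f δ ∎
  where
  open ≡-Reasoning
  insert-zero : ∀ {n} (i : Fin (suc n)) j → insertAt (λ _ → + 0) i (+ 0) j ≡ + 0
  insert-zero zero    zero    = refl
  insert-zero zero    (suc j) = refl
  insert-zero {suc n} (suc i) zero    = refl
  insert-zero {suc n} (suc i) (suc j) = insert-zero i j
  unfold : (λ r → insertAt (δ r) (suc j) (+ 0)) ≈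
           δ zero ∷ λ r → insertAt (insertAt (δ r) j (+ 0)) zero (+ 0)
  unfold zero    zero    = refl
  unfold zero    (suc c) = insert-zero j c
  unfold (suc r) zero    = refl
  unfold (suc r) (suc c) = refl
  fold : δ (suc j) ∷ (λ r → insertAt (insertAt (δ r) j (+ 0)) zero (+ 0)) ≈
         λ r → insertAt ((δ j ∷ λ r → insertAt (δ r) j (+ 0)) r) zero (+ 0)
  fold zero    zero    = refl
  fold zero    (suc c) = refl
  fold (suc r) c       = refl

-- Expanding the head row in unit rows and clearing the pivot column leaves an alternating function
-- of each minor; induction and `cycle-sign` then reproduce the Laplace expansion. Determinant
-- identities below follow by checking that one side is alternating and evaluating it at `δ`.
det-unique : ∀ {n} {f : Matrix n n → ℤ} → Alternating f → ∀ M → f M ≡ det M * f δ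
det-unique {zero}  {f} F M = trans (congr F λ ()) (sym (ℤ.*-identityˡ (f δ)))
det-unique {suc n} {f} F M = begin
  f M                                                             ≡⟨ congr F (∷-η M) ⟩
  f (M zero ∷ (M ∘ suc))                                          ≡⟨ expand-head F (M zero) (M ∘ suc) ⟩
  sum (λ j → M zero j * f (δ j ∷ (M ∘ suc)))                      ≡⟨ sum-cong-≗ term ⟩
  sum (λ j → sgn (toℕ j) * M zero j * det (minor j M) * f δ)
    ≡⟨ *-distribʳ-sum (f δ) (λ j → sgn (toℕ j) * M zero j * det (minor j M)) ⟨
  sum (λ j → sgn (toℕ j) * M zero j * det (minor j M)) * f δ      ≡⟨ cong (_* f δ) (det-suc M) ⟨
  det M * f δ                                                     ∎
  where
  open ≡-Reasoning
  rearrange : ∀ m d s x → m * (d * (s * x)) ≡ s * m * d * x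
  rearrange = solve-∀
  term : ∀ j → M zero j * f (δ j ∷ (M ∘ suc)) ≡ sgn (toℕ j) * M zero j * det (minor j M) * f δ
  term j = begin
    M zero j * f (δ j ∷ (M ∘ suc))
      ≡⟨ cong (M zero j *_) (clear-multiples (∷-alternating F (δ j)) (δ j)
           (λ i N h → repeated-head F i (δ j ∷ N) (sym ∘ h)) (λ i → M (suc i) j) (M ∘ suc) _
           (λ i → split-entry j (M (suc i)))) ⟩
    M zero j * f (δ j ∷ λ r → insertAt (minor j M r) j (+ 0))
      ≡⟨ cong (M zero j *_) (det-unique (insert-alternating F j) (minor j M)) ⟩
    M zero j * (det (minor j M) * f (δ j ∷ λ r → insertAt (δ r) j (+ 0)))
      ≡⟨ cong (λ z → M zero j * (det (minor j M) * z)) (cycle-sign F j) ⟩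
    M zero j * (det (minor j M) * (sgn (toℕ j) * f δ))
      ≡⟨ rearrange (M zero j) (det (minor j M)) (sgn (toℕ j)) (f δ) ⟩
    sgn (toℕ j) * M zero j * det (minor j M) * f δ ∎

-- Transposition and multiplicativity of the determinant

punchIn-adjacent : ∀ {n} (i k : Fin (suc n)) → toℕ k ≡ suc (toℕ i) →
                   ∀ c → punchIn i c ≡ punchIn k c ⊎ (punchIn i c ≡ k × punchIn k c ≡ i)
punchIn-adjacent zero    (suc zero) e zero    = inj₂ (refl , refl)
punchIn-adjacent zero    (suc zero) e (suc c) = inj₁ refl
punchIn-adjacent (suc i) (suc k)    e zero    = inj₁ refl
punchIn-adjacent (suc i) (suc k)    e (suc c) with punchIn-adjacent i k (ℕ.suc-injective e) c
... | inj₁ h       = inj₁ (cong suc h)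
... | inj₂ (h , l) = inj₂ (cong suc h , cong suc l)

punchOut-adjacent : ∀ {n} (j i k : Fin (suc n)) (j≢i : j ≢ i) (j≢k : j ≢ k) → toℕ k ≡ suc (toℕ i) →
                    toℕ (punchOut j≢k) ≡ suc (toℕ (punchOut j≢i))
punchOut-adjacent zero    zero    k       j≢i j≢k e = contradiction refl j≢i
punchOut-adjacent zero    (suc i) (suc k) j≢i j≢k e = ℕ.suc-injective e
punchOut-adjacent (suc zero) zero (suc zero) j≢i j≢k e = contradiction refl j≢k
punchOut-adjacent {suc (suc n)} (suc (suc j)) zero (suc zero) j≢i j≢k e = refl
punchOut-adjacent {suc n} (suc j) (suc i) (suc k) j≢i j≢k e =
  cong suc (punchOut-adjacent j i k (j≢i ∘ cong suc) (j≢k ∘ cong suc) (ℕ.suc-injective e))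

-- The transpose comes before `det` itself because its expansion runs along the first column of M,
-- so each minor omits exactly one row of M. Row `i` enters the term `j = i` only through the entry
-- and every other term only through the minor, which the recursion handles. Two equal rows would be
-- harder to treat in an expansion along one of them.
detᵀ-alternating : ∀ {n} → Alternating (λ (M : Matrix n n) → det (M ᵀ))
detᵀ-alternating .congr h = det-cong λ i j → h j i
detᵀ-alternating {suc n} .linear i a M U V h hU hV = begin
  det (M ᵀ)                    ≡⟨ det-suc (M ᵀ) ⟩
  sum (t M)                    ≡⟨ sum-cong-≗ term ⟩
  sum (λ j → a * t U j + t V j) ≡⟨ sum-linear a (t U) (t V) ⟩
  a * sum (t U) + sum (t V)    ≡⟨ cong₂ (λ x y → a * x + y) (det-suc (U ᵀ)) (det-suc (V ᵀ)) ⟨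
  a * det (U ᵀ) + det (V ᵀ)    ∎
  where
  open ≡-Reasoning
  t : Matrix (suc n) (suc n) → Fin (suc n) → ℤ
  t N j = sgn (toℕ j) * N j zero * det (minor j (N ᵀ))
  entry : ∀ s a u v d → s * (a * u + v) * d ≡ a * (s * u * d) + s * v * d
  entry = solve-∀
  cofactor : ∀ s a x y z → s * x * (a * y + z) ≡ a * (s * x * y) + s * x * z
  cofactor = solve-∀
  term : ∀ j → t M j ≡ a * t U j + t V j
  term j with j Fin.≟ i
  ... | yes refl = trans
    (cong₂ (λ x d → sgn (toℕ j) * x * d) (h zero) refl)
    (trans (entry (sgn (toℕ j)) a (U j zero) (V j zero) _)
      (cong₂ (λ x y → a * (sgn (toℕ j) * U j zero * x) + sgn (toℕ j) * V j zero * y)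
        (det-cong λ r c → hU (punchIn j c) (Fin.punchInᵢ≢i j c) (suc r))
        (det-cong λ r c → hV (punchIn j c) (Fin.punchInᵢ≢i j c) (suc r))))
  ... | no j≢i = trans
    (cong (sgn (toℕ j) * M j zero *_) (linear detᵀ-alternating (punchOut j≢i) a (rows M) (rows U) (rows V)
      (λ c → subst (λ k → M k (suc c) ≡ a * U k (suc c) + V k (suc c))
               (sym (Fin.punchIn-punchOut j≢i)) (h (suc c)))
      (λ k k≢ c → hU (punchIn j k) (λ e → k≢ (other k e)) (suc c))
      (λ k k≢ c → hV (punchIn j k) (λ e → k≢ (other k e)) (suc c))))
    (trans (cofactor (sgn (toℕ j)) a (M j zero) _ _)
      (cong₂ (λ x y → a * (sgn (toℕ j) * x * det (minor j (U ᵀ))) + sgn (toℕ j) * y * det (minor j (V ᵀ)))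
        (hU j j≢i zero) (hV j j≢i zero)))
    where
    rows : Matrix (suc n) (suc n) → Matrix n n
    rows N k c = N (punchIn j k) (suc c)
    other : ∀ k → punchIn j k ≡ i → k ≡ punchOut j≢i
    other k e = Fin.punchIn-injective j _ _ (trans e (sym (Fin.punchIn-punchOut j≢i)))
detᵀ-alternating {suc n} .adjacent i k e M h = begin
  det (M ᵀ)        ≡⟨ det-suc (M ᵀ) ⟩
  -- Deleting any third row keeps rows `i` and `k` consecutive, so its term vanishes by recursion.
  -- The two remaining terms have equal entries, equal minors and opposite signs.
  sum t            ≡⟨ sum-adjacent i k e others ⟩
  t i + t k        ≡⟨ cong (_+ t k) (cong₂ (λ x d → sgn (toℕ i) * x * d) (h zero) (det-cong minors)) ⟩
  sgn (toℕ i) * M k zero * det (minor k (M ᵀ)) + t k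
    ≡⟨ cong (λ z → sgn (toℕ i) * M k zero * det (minor k (M ᵀ)) + sgn z * M k zero * det (minor k (M ᵀ))) e ⟩
  sgn (toℕ i) * M k zero * det (minor k (M ᵀ)) + - sgn (toℕ i) * M k zero * det (minor k (M ᵀ))
    ≡⟨ cancel (sgn (toℕ i)) (M k zero) _ ⟩
  + 0              ∎
  where
  open ≡-Reasoning
  t : Fin (suc n) → ℤ
  t j = sgn (toℕ j) * M j zero * det (minor j (M ᵀ))
  cancel : ∀ s x d → s * x * d + - s * x * d ≡ + 0
  cancel = solve-∀
  minors : minor i (M ᵀ) ≈ minor k (M ᵀ)
  -- Deleting `i` or `k` leaves the same rows except in one place, which holds `k` in one minor and
  -- `i` in the other; these two rows agree.
  minors r c with punchIn-adjacent i k e c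
  ... | inj₁ eq = cong (λ z → M z (suc r)) eq
  ... | inj₂ (eq₁ , eq₂) = trans (cong (λ z → M z (suc r)) eq₁)
                             (trans (sym (h (suc r))) (cong (λ z → M z (suc r)) (sym eq₂)))
  others : ∀ j → j ≢ i → j ≢ k → t j ≡ + 0
  others j j≢i j≢k = trans
    (cong (sgn (toℕ j) * M j zero *_)
      (adjacent detᵀ-alternating (punchOut j≢i) (punchOut j≢k) (punchOut-adjacent j i k j≢i j≢k e)
        (λ c r → M (punchIn j c) (suc r))
        (λ c → trans (cong (λ z → M z (suc c)) (Fin.punchIn-punchOut j≢i))
                 (trans (h (suc c)) (cong (λ z → M z (suc c)) (sym (Fin.punchIn-punchOut j≢k)))))))
    (ℤ.*-zeroʳ (sgn (toℕ j) * M j zero))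

det-head : ∀ n a (M : Matrix (suc n) (suc n)) → (∀ j → M zero j ≡ a * δ zero j) →
           det M ≡ a * det (minor zero M)
det-head n a M h = begin
  det M                                ≡⟨ det-suc M ⟩
  sum t                                ≡⟨ sum-single zero {t} others ⟩
  + 1 * M zero zero * det (minor zero M)
    ≡⟨ cong (λ x → + 1 * x * det (minor zero M)) (h zero) ⟩
  + 1 * (a * (+ 1)) * det (minor zero M) ≡⟨ simplify a (det (minor zero M)) ⟩
  a * det (minor zero M)               ∎
  where
  open ≡-Reasoning
  t : Fin (suc n) → ℤ
  t j = sgn (toℕ j) * M zero j * det (minor j M)
  vanish : ∀ s a d → s * (a * (+ 0)) * d ≡ + 0
  vanish = solve-∀
  simplify : ∀ a d → + 1 * (a * (+ 1)) * d ≡ a * d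
  simplify = solve-∀
  others : ∀ j → j ≢ zero → t j ≡ + 0
  others zero    0≢0 = contradiction refl 0≢0
  others (suc j) _   = trans (cong (λ x → sgn (suc (toℕ j)) * x * det (minor (suc j) M)) (h (suc j)))
                             (vanish (sgn (suc (toℕ j))) a (det (minor (suc j) M)))

det-δ : ∀ n → det (δ {n}) ≡ + 1
det-δ zero    = refl
det-δ (suc n) = trans (det-head n (+ 1) δ λ j → sym (ℤ.*-identityˡ (δ zero j)))
                      (trans (ℤ.*-identityˡ (det {n} δ)) (det-δ n))

det-ᵀ : ∀ {n} (M : Matrix n n) → det (M ᵀ) ≡ det M
det-ᵀ {n} M = begin
  det (M ᵀ)              ≡⟨ det-unique detᵀ-alternating M ⟩
  det M * det (δ {n} ᵀ)  ≡⟨ cong (det M *_) (trans (det-cong {n} λ i j → δ-sym j i) (det-δ n)) ⟩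
  det M * (+ 1)          ≡⟨ ℤ.*-identityʳ (det M) ⟩
  det M                  ∎
  where open ≡-Reasoning

det-alternating : ∀ {n} → Alternating (det {n})
det-alternating .linear i a M U V h hU hV = begin
  det M                      ≡⟨ det-ᵀ M ⟨
  det (M ᵀ)                  ≡⟨ linear detᵀ-alternating i a M U V h hU hV ⟩
  a * det (U ᵀ) + det (V ᵀ)  ≡⟨ cong₂ (λ x y → a * x + y) (det-ᵀ U) (det-ᵀ V) ⟩
  a * det U + det V          ∎
  where open ≡-Reasoning
det-alternating .adjacent i k e M h = trans (sym (det-ᵀ M)) (adjacent detᵀ-alternating i k e M h)
det-alternating .congr = det-cong

det-· : ∀ {n} (A B : Matrix n n) → det (A · B) ≡ det A * det B
det-· A B = trans (det-unique alt A) (cong (det A *_) (det-cong (·-identityˡ B)))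
  where
  alt : Alternating (λ M → det (M · B))
  alt .linear i a M U V h hU hV = linear det-alternating i a _ _ _
    (λ j → trans (sum-cong-≗ λ k → trans (cong (_* B k j) (h k)) (distrib a (U i k) (V i k) (B k j)))
             (sum-linear a (λ k → U i k * B k j) (λ k → V i k * B k j)))
    (λ r r≢i j → sum-cong-≗ λ k → cong (_* B k j) (hU r r≢i k))
    (λ r r≢i j → sum-cong-≗ λ k → cong (_* B k j) (hV r r≢i k))
    where
    distrib : ∀ a u v b → (a * u + v) * b ≡ a * (u * b) + v * b
    distrib = solve-∀
  alt .adjacent i k e M h = adjacent det-alternating i k e _ λ j → sum-cong-≗ λ l → cong (_* B l j) (h l)
  alt .congr h = det-cong (·-cong h λ _ _ → refl)

scalar : ∀ {n} → ℤ → Matrix n n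
scalar a i j = a * δ i j

·-scalar : ∀ {m n} (M : Matrix m n) a → M · scalar a ≈ λ i j → a * M i j
·-scalar M a i j = trans (sum-cong-≗ λ k → rearrange (M i k) a (δ k j))
  (trans (sym (*-distribˡ-sum a λ k → M i k * δ k j)) (cong (a *_) (·-identityʳ M i j)))
  where
  rearrange : ∀ m a d → m * (a * d) ≡ a * (m * d)
  rearrange = solve-∀

det-scalar : ∀ n a → det (scalar {n} a) ≡ a ^ n
det-scalar zero    a = refl
det-scalar (suc n) a = trans (det-head n a (scalar a) λ _ → refl) (cong (a *_) (det-scalar n a))

infixl 6 _⊕_
_⊕_ : ∀ {m n} → Matrix m n → Matrix m n → Matrix m n
(M ⊕ N) i j = M i j + N i j

infixl 7 _⊙_
_⊙_ : ∀ {m n} → ℤ → Matrix m n → Matrix m n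
(a ⊙ M) i j = a * M i j

O : ∀ {m n} → Matrix m n
O i j = + 0

⊕-cong : ∀ {m n} {M M′ N N′ : Matrix m n} → M ≈ M′ → N ≈ N′ → M ⊕ N ≈ M′ ⊕ N′
⊕-cong h k i j = cong₂ _+_ (h i j) (k i j)

·-zeroˡ : ∀ {l m n} (M : Matrix m n) → O {l} · M ≈ O
·-zeroˡ M i j = sum-zero λ k → ℤ.*-zeroˡ (M k j)

·-zeroʳ : ∀ {l m n} (M : Matrix m n) → M · O {n} {l} ≈ O
·-zeroʳ M i j = sum-zero λ k → ℤ.*-zeroʳ (M i k)

⊙-· : ∀ {l m n} a (M : Matrix l m) (N : Matrix m n) → (a ⊙ M) · N ≈ a ⊙ (M · N)
⊙-· a M N i j = trans (sum-cong-≗ λ k → ℤ.*-assoc a (M i k) (N k j))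
  (sym (*-distribˡ-sum a λ k → M i k * N k j))

-- Block matrices and rank updates

module _ {m n m′ n′} (A : Matrix m m′) (B : Matrix m n′) (C : Matrix n m′) (D : Matrix n n′) where

  blockEntry : Fin m ⊎ Fin n → Fin m′ ⊎ Fin n′ → ℤ
  blockEntry (inj₁ i) (inj₁ j) = A i j
  blockEntry (inj₁ i) (inj₂ j) = B i j
  blockEntry (inj₂ i) (inj₁ j) = C i j
  blockEntry (inj₂ i) (inj₂ j) = D i j

  block : Matrix (m ℕ.+ n) (m′ ℕ.+ n′)
  block i j = blockEntry (splitAt m i) (splitAt m′ j)

block-cong : ∀ {m n m′ n′} {A A₁ : Matrix m m′} {B B₁ : Matrix m n′} {C C₁ : Matrix n m′} {D D₁ : Matrix n n′} →
             A ≈ A₁ → B ≈ B₁ → C ≈ C₁ → D ≈ D₁ → block A B C D ≈ block A₁ B₁ C₁ D₁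
block-cong {m} {n} {m′} ha hb hc hd i j with splitAt m i | splitAt m′ j
... | inj₁ k | inj₁ l = ha k l
... | inj₁ k | inj₂ l = hb k l
... | inj₂ k | inj₁ l = hc k l
... | inj₂ k | inj₂ l = hd k l

block-ᵀ : ∀ {m n m′ n′} (A : Matrix m m′) (B : Matrix m n′) (C : Matrix n m′) (D : Matrix n n′) →
          block A B C D ᵀ ≈ block (A ᵀ) (C ᵀ) (B ᵀ) (D ᵀ)
block-ᵀ {m} {n} {m′} A B C D i j with splitAt m′ i | splitAt m j
... | inj₁ k | inj₁ l = refl
... | inj₁ k | inj₂ l = refl
... | inj₂ k | inj₁ l = refl
... | inj₂ k | inj₂ l = refl

block-· : ∀ {m n m′ n′ m″ n″}
          (A : Matrix m m′) (B : Matrix m n′) (C : Matrix n m′) (D : Matrix n n′)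
          (A₁ : Matrix m′ m″) (B₁ : Matrix m′ n″) (C₁ : Matrix n′ m″) (D₁ : Matrix n′ n″) →
          block A B C D · block A₁ B₁ C₁ D₁ ≈
          block (A · A₁ ⊕ B · C₁) (A · B₁ ⊕ B · D₁) (C · A₁ ⊕ D · C₁) (C · B₁ ⊕ D · D₁)
block-· {m} {n} {m′} {n′} {m″} A B C D A₁ B₁ C₁ D₁ i j = trans
  (sum-splitAt m′ λ s → blockEntry A B C D (splitAt m i) s * blockEntry A₁ B₁ C₁ D₁ s (splitAt m″ j))
  (cases (splitAt m i) (splitAt m″ j))
  where
  cases : ∀ s t → sum (λ k → blockEntry A B C D s (inj₁ k) * blockEntry A₁ B₁ C₁ D₁ (inj₁ k) t) +
                  sum (λ k → blockEntry A B C D s (inj₂ k) * blockEntry A₁ B₁ C₁ D₁ (inj₂ k) t) ≡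
                  blockEntry (A · A₁ ⊕ B · C₁) (A · B₁ ⊕ B · D₁) (C · A₁ ⊕ D · C₁) (C · B₁ ⊕ D · D₁) s t
  cases (inj₁ k) (inj₁ l) = refl
  cases (inj₁ k) (inj₂ l) = refl
  cases (inj₂ k) (inj₁ l) = refl
  cases (inj₂ k) (inj₂ l) = refl

det-block-δ : ∀ m {n} (X : Matrix n m) (D : Matrix n n) → det (block (δ {m}) O X D) ≡ det D
det-block-δ zero    X D = refl
det-block-δ (suc m) {n} X D = begin
  det (block δ O X D)                     ≡⟨ det-head (m ℕ.+ n) (+ 1) (block δ O X D) head ⟩
  + 1 * det (minor zero (block δ O X D))  ≡⟨ ℤ.*-identityˡ _ ⟩
  det (minor zero (block δ O X D))        ≡⟨ det-cong rest ⟩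
  det (block δ O (λ i j → X i (suc j)) D) ≡⟨ det-block-δ m (λ i j → X i (suc j)) D ⟩
  det D                                   ∎
  where
  open ≡-Reasoning
  head : ∀ j → block δ O X D zero j ≡ + 1 * δ zero j
  head zero    = refl
  head (suc j) with splitAt m j
  ... | inj₁ _ = refl
  ... | inj₂ _ = refl
  rest : minor zero (block δ O X D) ≈ block δ O (λ i j → X i (suc j)) D
  rest i j with splitAt m i | splitAt m j
  ... | inj₁ k | inj₁ l = refl
  ... | inj₁ k | inj₂ l = refl
  ... | inj₂ k | inj₁ l = refl
  ... | inj₂ k | inj₂ l = refl

-- The left side is alternating in the rows of `A`, so only the case of an identity block remains.
det-block-lower : ∀ {m n} (A : Matrix m m) (X : Matrix n m) (D : Matrix n n) →
                  det (block A O X D) ≡ det A * det D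
det-block-lower {m} {n} A X D = trans (det-unique alt A) (cong (det A *_) (det-block-δ m X D))
  where
  row : ∀ {a} {M U V : Matrix m m} i → (∀ j → M i j ≡ a * U i j + V i j) →
        ∀ j → block M O X D (i ↑ˡ n) j ≡ a * block U O X D (i ↑ˡ n) j + block V O X D (i ↑ˡ n) j
  row {a} i h j rewrite Fin.splitAt-↑ˡ m i n with splitAt m j
  ... | inj₁ l = h l
  ... | inj₂ l = sym (trans (ℤ.+-identityʳ (a * + 0)) (ℤ.*-zeroʳ a))
  others : ∀ {M U : Matrix m m} i → (∀ k → k ≢ i → ∀ j → M k j ≡ U k j) →
           ∀ k → k ≢ i ↑ˡ n → ∀ j → block M O X D k j ≡ block U O X D k j
  others i h k k≢i j with splitAt m k in eq | splitAt m j
  ... | inj₁ r | inj₁ l = h r (λ r≡i → k≢i (trans (sym (Fin.splitAt⁻¹-↑ˡ eq)) (cong (_↑ˡ n) r≡i))) l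
  ... | inj₁ r | inj₂ l = refl
  ... | inj₂ r | inj₁ l = refl
  ... | inj₂ r | inj₂ l = refl
  alt : Alternating (λ M → det (block M O X D))
  alt .linear i a M U V h hU hV =
    linear det-alternating (i ↑ˡ n) a _ _ _ (row {a} {M} {U} {V} i h) (others {M} {U} i hU) (others {M} {V} i hV)
  alt .adjacent i k e M h = repeated det-alternating (i ↑ˡ n) (k ↑ˡ n)
    (λ i≡k → ℕ.1+n≢n (trans (sym e) (cong toℕ (sym (Fin.↑ˡ-injective n i k i≡k))))) (block M O X D) eq
    where
    eq : ∀ j → block M O X D (i ↑ˡ n) j ≡ block M O X D (k ↑ˡ n) j
    eq j rewrite Fin.splitAt-↑ˡ m i n | Fin.splitAt-↑ˡ m k n with splitAt m j
    ... | inj₁ l = h l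
    ... | inj₂ l = refl
  alt .congr h = det-cong (block-cong h (λ _ _ → refl) (λ _ _ → refl) (λ _ _ → refl))

det-block-upper : ∀ {m n} (A : Matrix m m) (B : Matrix m n) (D : Matrix n n) →
                  det (block A B O D) ≡ det A * det D
det-block-upper A B D = begin
  det (block A B O D)                ≡⟨ det-ᵀ (block A B O D) ⟨
  det (block A B O D ᵀ)              ≡⟨ det-cong (block-ᵀ A B O D) ⟩
  det (block (A ᵀ) O (B ᵀ) (D ᵀ))    ≡⟨ det-block-lower (A ᵀ) (B ᵀ) (D ᵀ) ⟩
  det (A ᵀ) * det (D ᵀ)              ≡⟨ cong₂ _*_ (det-ᵀ A) (det-ᵀ D) ⟩
  det A * det D                      ∎
  where open ≡-Reasoning

-- Both sides are values of det L * aⁿ for L = [δ Y; -X K]: clearing -X from the left gives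
-- [δ Y; O K+XY], and clearing it from the right, where KX = aX, gives [a+YX Y; O K].
det-update : ∀ {m n} a (K : Matrix m m) (X : Matrix m n) (Y : Matrix n m) → K · X ≈ a ⊙ X →
             det (K ⊕ X · Y) * a ^ n ≡ det K * det (scalar a ⊕ Y · X)
det-update {m} {n} a K X Y h = begin
  det (K ⊕ X · Y) * a ^ n              ≡⟨ cong (_* a ^ n) left ⟨
  det L * a ^ n                        ≡⟨ cong (det L *_) detR ⟨
  det L * det (block (scalar a) O X (δ {m}))  ≡⟨ det-· L (block (scalar a) O X (δ {m})) ⟨
  det (L · block (scalar a) O X δ)     ≡⟨ det-cong right ⟩
  det (block (scalar a ⊕ Y · X) Y O K) ≡⟨ det-block-upper (scalar a ⊕ Y · X) Y K ⟩
  det (scalar a ⊕ Y · X) * det K       ≡⟨ ℤ.*-comm (det (scalar a ⊕ Y · X)) (det K) ⟩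
  det K * det (scalar a ⊕ Y · X)       ∎
  where
  open ≡-Reasoning
  L : Matrix (n ℕ.+ m) (n ℕ.+ m)
  L = block δ Y (- + 1 ⊙ X) K
  detR : det (block (scalar a) O X (δ {m})) ≡ a ^ n
  detR = trans (det-block-lower (scalar a) X δ)
    (trans (cong₂ _*_ (det-scalar n a) (det-δ m)) (ℤ.*-identityʳ (a ^ n)))
  +-identity : ∀ {x y z : ℤ} → x ≡ y → z ≡ + 0 → x + z ≡ y
  +-identity h k = trans (cong₂ _+_ h k) (ℤ.+-identityʳ _)
  +-identity′ : ∀ {x y z : ℤ} → z ≡ + 0 → x ≡ y → z + x ≡ y
  +-identity′ h k = trans (cong₂ _+_ h k) (ℤ.+-identityˡ _)
  cancelˡ : ∀ x → x + - + 1 * x ≡ + 0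
  cancelˡ = solve-∀
  cancelʳ : ∀ a x → - + 1 * (a * x) + a * x ≡ + 0
  cancelʳ = solve-∀
  left : det L ≡ det (K ⊕ X · Y)
  left = begin
    det L                                   ≡⟨ ℤ.*-identityˡ (det L) ⟨
    + 1 * det L
      ≡⟨ cong (_* det L) (trans (det-block-δ n X (δ {m})) (det-δ m)) ⟨
    det (block (δ {n}) O X (δ {m})) * det L ≡⟨ det-· (block (δ {n}) O X (δ {m})) L ⟨
    det (block (δ {n}) O X (δ {m}) · L)
      ≡⟨ det-cong (≈-trans (block-· δ O X δ δ Y (- + 1 ⊙ X) K) (block-cong
           (λ i j → +-identity (·-identityˡ δ i j) (·-zeroˡ (- + 1 ⊙ X) i j))
           (λ i j → +-identity (·-identityˡ Y i j) (·-zeroˡ K i j))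
           (λ i j → trans (cong₂ _+_ (·-identityʳ X i j) (·-identityˡ (- + 1 ⊙ X) i j)) (cancelˡ (X i j)))
           (λ i j → trans (cong (_+_ ((X · Y) i j)) (·-identityˡ K i j)) (ℤ.+-comm ((X · Y) i j) (K i j))))) ⟩
    det (block (δ {n}) Y O (K ⊕ X · Y))     ≡⟨ det-block-upper (δ {n}) Y (K ⊕ X · Y) ⟩
    det (δ {n}) * det (K ⊕ X · Y)           ≡⟨ cong (_* det (K ⊕ X · Y)) (det-δ n) ⟩
    + 1 * det (K ⊕ X · Y)                   ≡⟨ ℤ.*-identityˡ (det (K ⊕ X · Y)) ⟩
    det (K ⊕ X · Y)                         ∎
  right : L · block (scalar a) O X δ ≈ block (scalar a ⊕ Y · X) Y O K
  right = ≈-trans (block-· δ Y (- + 1 ⊙ X) K (scalar a) O X δ) (block-cong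
    (λ i j → cong (_+ (Y · X) i j) (·-identityˡ (scalar a) i j))
    (λ i j → +-identity′ (·-zeroʳ δ i j) (·-identityʳ Y i j))
    (λ i j → trans (cong₂ _+_ (trans (⊙-· (- + 1) X (scalar a) i j) (cong (- + 1 *_) (·-scalar X a i j))) (h i j))
                   (cancelʳ a (X i j)))
    (λ i j → +-identity′ (·-zeroʳ (- + 1 ⊙ X) i j) (·-identityʳ K i j)))

-- Matrices fibered over a base

-- One step of the recursion of `remQuot`, separated from `splitAt` so that sums and blocks over a
-- product can be treated by induction on `n`.
rowJoin : ∀ {n p} → Fin p ⊎ Fin (n ℕ.* p) → Fin (suc n) × Fin p
rowJoin (inj₁ j) = zero , j
rowJoin {n} {p} (inj₂ i) = let q , r = remQuot {n} p i in suc q , r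

remQuot-splitAt : ∀ {n} p (i : Fin (suc n ℕ.* p)) → remQuot {suc n} p i ≡ rowJoin (splitAt p i)
remQuot-splitAt p i with splitAt p i
... | inj₁ _ = refl
... | inj₂ _ = refl

sum-remQuot : ∀ n {p} (f : Fin n × Fin p → ℤ) →
              sum (λ k → f (remQuot {n} p k)) ≡ sum λ i → sum λ j → f (i , j)
sum-remQuot zero    f = refl
sum-remQuot (suc n) {p} f = begin
  sum (λ k → f (remQuot {suc n} p k))          ≡⟨ sum-cong-≗ (λ k → cong f (remQuot-splitAt p k)) ⟩
  sum (λ k → f (rowJoin (splitAt p k)))        ≡⟨ sum-splitAt p (f ∘ rowJoin) ⟩
  sum (λ j → f (zero , j)) + sum (λ k → f (rowJoin (inj₂ k)))
    ≡⟨ cong (_+_ (sum λ j → f (zero , j))) (sum-remQuot n λ (i , j) → f (suc i , j)) ⟩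
  sum (λ i → sum λ j → f (i , j))              ∎
  where open ≡-Reasoning

module _ {n p} (B : Matrix n n) (C : Matrix p p) where

  fiberedEntry : Fin n × Fin p → Fin n × Fin p → ℤ
  fiberedEntry (i , k) (j , l) = δ i j * C k l + B i j

  -- δ ⊗ C + B ⊗ J with J the all-ones matrix.
  fibered : Matrix (n ℕ.* p) (n ℕ.* p)
  fibered i j = fiberedEntry (remQuot {n} p i) (remQuot {n} p j)

det-δ⊗ : ∀ n {p} (C : Matrix p p) → det (fibered (O {n}) C) ≡ det C ^ n
det-δ⊗ zero    C = refl
det-δ⊗ (suc n) {p} C = begin
  det (fibered (O {suc n}) C)            ≡⟨ det-cong entries ⟩
  det (block C O O (fibered (O {n}) C))  ≡⟨ det-block-lower C O (fibered (O {n}) C) ⟩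
  det C * det (fibered (O {n}) C)        ≡⟨ cong (det C *_) (det-δ⊗ n C) ⟩
  det C * det C ^ n                      ∎
  where
  open ≡-Reasoning
  one : ∀ x → + 1 * x + + 0 ≡ x
  one = solve-∀
  entries : fibered (O {suc n}) C ≈ block C O O (fibered (O {n}) C)
  entries i j with splitAt p i | splitAt p j
  ... | inj₁ k | inj₁ l = one (C k l)
  ... | inj₁ k | inj₂ l = refl
  ... | inj₂ k | inj₁ l = refl
  ... | inj₂ k | inj₂ l = refl

sum-constant : ∀ n c → sum {n} (λ _ → c) ≡ + n * c
sum-constant zero    c = sym (ℤ.*-zeroˡ c)
sum-constant (suc n) c = trans (cong (_+_ c) (sum-constant n c)) (sym (ℤ.suc-* (+ n) c))

-- The part with `B` is an update `X · Y` of the block-diagonal `K`, where the columns of `X` are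
-- the indicators of the fibers. Constant row sums make `K · X` equal to a times `X`, and `Y · X` is
-- p times `B` because a fiber has p points; so `det-update` shrinks the determinant to the size of
-- the base.
det-fibered : ∀ {n p} a (B : Matrix n n) (C : Matrix p p) → (∀ k → sum (C k) ≡ a) →
              det (fibered B C) * a ^ n ≡ det C ^ n * det (scalar a ⊕ + p ⊙ B)
det-fibered {n} {p} a B C h = begin
  det (fibered B C) * a ^ n
    ≡⟨ cong (_* a ^ n) (det-cong {N = K ⊕ X · Y} λ i j → sym (split i j)) ⟩
  det (K ⊕ X · Y) * a ^ n
    ≡⟨ det-update a K X Y eigen ⟩
  det K * det (scalar a ⊕ Y · X)
    ≡⟨ cong₂ _*_ (det-δ⊗ n C) (det-cong (⊕-cong {M = scalar a} (λ _ _ → refl) YX)) ⟩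
  det C ^ n * det (scalar a ⊕ + p ⊙ B) ∎
  where
  open ≡-Reasoning
  quot : Fin (n ℕ.* p) → Fin n
  quot i = proj₁ (remQuot {n} p i)
  rem : Fin (n ℕ.* p) → Fin p
  rem i = proj₂ (remQuot {n} p i)
  K : Matrix (n ℕ.* p) (n ℕ.* p)
  K = fibered (O {n}) C
  X : Matrix (n ℕ.* p) n
  X i k = δ (quot i) k
  Y : Matrix n (n ℕ.* p)
  Y k j = B k (quot j)
  split : K ⊕ X · Y ≈ fibered B C
  split i j = cong₂ _+_ (ℤ.+-identityʳ (δ (quot i) (quot j) * C (rem i) (rem j))) (sum-δˡ (quot i) λ k → B k (quot j))
  eigen : K · X ≈ a ⊙ X
  eigen i k = begin
    (K · X) i k
      ≡⟨ sum-remQuot n (λ s → fiberedEntry (O {n}) C (remQuot {n} p i) s * δ (proj₁ s) k) ⟩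
    sum (λ j → sum λ l → (δ q j * C r l + + 0) * δ j k)
      ≡⟨ sum-cong-≗ (λ j → trans (sum-cong-≗ λ l → regroup (δ q j) (C r l) (δ j k))
           (sym (*-distribˡ-sum (δ q j * δ j k) (C r)))) ⟩
    sum (λ j → δ q j * δ j k * sum (C r))
      ≡⟨ sum-cong-≗ (λ j → trans (cong (δ q j * δ j k *_) (h r)) (ℤ.*-assoc (δ q j) (δ j k) a)) ⟩
    sum (λ j → δ q j * (δ j k * a))  ≡⟨ sum-δˡ q (λ j → δ j k * a) ⟩
    δ q k * a                        ≡⟨ ℤ.*-comm (δ q k) a ⟩
    a * δ q k                        ∎
    where
    q = quot i
    r = rem i
    regroup : ∀ x c y → (x * c + + 0) * y ≡ x * y * c
    regroup = solve-∀
  YX : Y · X ≈ + p ⊙ B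
  YX k l = begin
    sum (λ j → B k (quot j) * δ (quot j) l)  ≡⟨ sum-remQuot n (λ s → B k (proj₁ s) * δ (proj₁ s) l) ⟩
    sum (λ j → sum {p} λ _ → B k j * δ j l)  ≡⟨ sum-cong-≗ (λ j → sum-constant p (B k j * δ j l)) ⟩
    sum (λ j → + p * (B k j * δ j l))        ≡⟨ *-distribˡ-sum (+ p) (λ j → B k j * δ j l) ⟨
    + p * sum (λ j → B k j * δ j l)          ≡⟨ cong (+ p *_) (sum-δʳ l (B k)) ⟩
    + p * B k l                              ∎

-- The p-th power of a sum modulo p

prime∤! : ∀ {p} → Prime p → ∀ k → k < p → ¬ p ∣ k !
prime∤! {p} pp zero _ p∣1 = ℕ.nonTrivial⇒≢1 {{prime⇒nonTrivial pp}} (ℕ.∣1⇒≡1 p∣1)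
prime∤! {p} pp (suc k) k<p p∣k! with euclidsLemma (suc k) (k !) pp p∣k!
... | inj₁ p∣k  = ℕ.>⇒∤ k<p p∣k
... | inj₂ p∣k! = prime∤! pp k (ℕ.<-trans (ℕ.n<1+n k) k<p) p∣k!

prime∣choose : ∀ {p} → Prime p → ∀ k → 0 ℕ.< k → k < p → p ∣ p choose k
prime∣choose {p} pp k 0<k k<p with euclidsLemma (p choose k) (k ! ℕ.* (p ∸ k) !) pp p∣product
  where
  instance _ = k ℕ.!* (p ∸ k) !≢0
  p∣p! : ∀ {p} → 0 ℕ.< p → p ∣ p !
  p∣p! {suc q} _ = ℕ.m∣m*n (q !)
  p∣product : p ∣ (p choose k) ℕ.* (k ! ℕ.* (p ∸ k) !)
  p∣product = subst (p ∣_)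
    (trans (sym (m/n*n≡m (k![n∸k]!∣n! (ℕ.<⇒≤ k<p))))
           (cong (ℕ._* (k ! ℕ.* (p ∸ k) !)) (sym (nCk≡n!/k![n-k]! (ℕ.<⇒≤ k<p)))))
    (p∣p! (ℕ.<-trans 0<k k<p))
... | inj₁ p∣choose = p∣choose
... | inj₂ p∣k!l! with euclidsLemma (k !) ((p ∸ k) !) pp p∣k!l!
...   | inj₁ p∣k! = contradiction p∣k! (prime∤! pp k k<p)
...   | inj₂ p∣l! = contradiction p∣l! (prime∤! pp (p ∸ k) (ℕ.∸-monoʳ-< 0<k (ℕ.<⇒≤ k<p)))

module _ {c ℓ} (S : Semiring c ℓ) where

  private
    module S = Semiring S
  open SemiringExp S using () renaming (_^_ to _^ˢ_)
  open SemiringMult S using (×-congˡ; ×-assocˡ; ×-homo-1) renaming (_×_ to _×ˢ_)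
  open CommutativeMonoidMult S.+-commutativeMonoid using (×-distrib-+)
  open SemiringSum S using () renaming (sum to sumˢ; sum-init-last to sumˢ-init-last)

  sum-multiple : ∀ q {n} (f : Fin n → S.Carrier) → (∀ i → ∃ λ w → f i S.≈ q ×ˢ w) → ∃ λ w → sumˢ f S.≈ q ×ˢ w
  sum-multiple q {zero}  f h = S.0# , S.sym (zero-multiple q)
    where
    zero-multiple : ∀ q → q ×ˢ S.0# S.≈ S.0#
    zero-multiple zero    = S.refl
    zero-multiple (suc q) = S.trans (S.+-identityˡ _) (zero-multiple q)
  sum-multiple q {suc n} f h with h zero | sum-multiple q (f ∘ suc) (h ∘ suc)
  ... | w , fw | v , fv = w S.+ v , S.trans (S.+-cong fw fv) (S.sym (×-distrib-+ w v q))

  -- The inner binomial coefficients are divisible by p. A general semiring with a commuting pair is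
  -- used because matrices do not all commute, and the error term is carried by a witness `w`.
  freshman's-dream : ∀ {p} → Prime p → ∀ x y → x S.* y S.≈ y S.* x →
                     ∃ λ w → (x S.+ y) ^ˢ p S.≈ (x ^ˢ p S.+ y ^ˢ p) S.+ p ×ˢ w
  freshman's-dream {suc q} pp x y xy≈yx with sum-multiple p (λ k → binomialTerm p (suc (inject₁ k))) middle
    where
    open SemiringBinomial S x y
    p = suc q
    middle : ∀ k → ∃ λ w → binomialTerm p (suc (inject₁ k)) S.≈ p ×ˢ w
    middle k with prime∣choose pp (suc (toℕ (inject₁ k))) (ℕ.s≤s ℕ.z≤n)
                    (ℕ.s≤s (subst (ℕ._< q) (sym (Fin.toℕ-inject₁ k)) (Fin.toℕ<n k)))
    ... | ℕ.divides c eq = c ×ˢ binomial p (suc (inject₁ k)) ,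
      S.trans (×-congˡ {binomial p (suc (inject₁ k))} (trans eq (ℕ.*-comm c p)))
              (S.sym (×-assocˡ (binomial p (suc (inject₁ k))) p c))
  ... | w , hw = w , (begin
    (x S.+ y) ^ˢ p                                              ≈⟨ theorem xy≈yx p ⟩
    binomialTerm p zero S.+ sumˢ (λ k → binomialTerm p (suc k))
      ≈⟨ S.+-cong first (S.trans (sumˢ-init-last (λ k → binomialTerm p (suc k))) (S.+-cong hw last)) ⟩
    y ^ˢ p S.+ (p ×ˢ w S.+ x ^ˢ p)                               ≈⟨ S.+-comm _ _ ⟩
    (p ×ˢ w S.+ x ^ˢ p) S.+ y ^ˢ p                               ≈⟨ S.+-assoc _ _ _ ⟩
    p ×ˢ w S.+ (x ^ˢ p S.+ y ^ˢ p)                               ≈⟨ S.+-comm _ _ ⟩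
    (x ^ˢ p S.+ y ^ˢ p) S.+ p ×ˢ w                               ∎)
    where
    open SemiringBinomial S x y
    open import Relation.Binary.Reasoning.Setoid S.setoid
    p = suc q
    first : binomialTerm p zero S.≈ y ^ˢ p
    first = S.trans (×-homo-1 _) (S.*-identityˡ _)
    last : binomialTerm p (suc (fromℕ q)) S.≈ x ^ˢ p
    last rewrite Fin.toℕ-fromℕ q | nCn≡1 p | ℕ.n∸n≡0 q = S.trans (×-homo-1 _) (S.*-identityʳ _)

-- The semiring of square matrices and their powers

·-⊕-distribˡ : ∀ {l m n} (M : Matrix l m) (N P : Matrix m n) → M · (N ⊕ P) ≈ M · N ⊕ M · P
·-⊕-distribˡ M N P i j = trans (sum-cong-≗ λ k → ℤ.*-distribˡ-+ (M i k) (N k j) (P k j))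
  (∑-distrib-+ (λ k → M i k * N k j) (λ k → M i k * P k j))

·-⊕-distribʳ : ∀ {l m n} (P : Matrix m n) (M N : Matrix l m) → (M ⊕ N) · P ≈ M · P ⊕ N · P
·-⊕-distribʳ P M N i j = trans (sum-cong-≗ λ k → ℤ.*-distribʳ-+ (P k j) (M i k) (N i k))
  (∑-distrib-+ (λ k → M i k * P k j) (λ k → N i k * P k j))

matrixSemiring : ℕ → Semiring 0ℓ 0ℓ
matrixSemiring n = record
  { Carrier = Matrix n n ; _≈_ = _≈_ ; _+_ = _⊕_ ; _*_ = _·_ ; 0# = O ; 1# = δ
  ; isSemiring = record
    { isSemiringWithoutAnnihilatingZero = record
      { +-isCommutativeMonoid = record
        { isMonoid = record
          { isSemigroup = record
            { isMagma = record
              { isEquivalence = record { refl = λ _ _ → refl ; sym = ≈-sym ; trans = ≈-trans }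
              ; ∙-cong = ⊕-cong }
            ; assoc = λ M N P i j → ℤ.+-assoc (M i j) (N i j) (P i j) }
          ; identity = (λ M i j → ℤ.+-identityˡ (M i j)) , λ M i j → ℤ.+-identityʳ (M i j) }
        ; comm = λ M N i j → ℤ.+-comm (M i j) (N i j) }
      ; *-cong = ·-cong
      ; *-assoc = ·-assoc
      ; *-identity = ·-identityˡ , ·-identityʳ
      ; distrib = ·-⊕-distribˡ , ·-⊕-distribʳ }
    ; zero = ·-zeroˡ , ·-zeroʳ } }

infixr 8 _^ᴹ_
_^ᴹ_ : ∀ {n} → Matrix n n → ℕ → Matrix n n
_^ᴹ_ {n} = SemiringExp._^_ (matrixSemiring n)

^ᴹ-cong : ∀ {n} k {X Y : Matrix n n} → X ≈ Y → X ^ᴹ k ≈ Y ^ᴹ k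
^ᴹ-cong {n} k = SemiringExp.^-congˡ (matrixSemiring n) k

det-^ᴹ : ∀ {n} (X : Matrix n n) k → det (X ^ᴹ k) ≡ det X ^ k
det-^ᴹ {n} X zero    = det-δ n
det-^ᴹ X (suc k) = trans (det-· X (X ^ᴹ k)) (cong (det X *_) (det-^ᴹ X k))

freshman's-dreamᴹ : ∀ {p n} → Prime p → (X Y : Matrix n n) → X · Y ≈ Y · X →
                    ∃ λ W → (X ⊕ Y) ^ᴹ p ≈ X ^ᴹ p ⊕ Y ^ᴹ p ⊕ + p ⊙ W
freshman's-dreamᴹ {p} {n} pp X Y XY≈YX with freshman's-dream (matrixSemiring n) pp X Y XY≈YX
... | W , h = W , ≈-trans h (⊕-cong {M = X ^ᴹ p ⊕ Y ^ᴹ p} (λ _ _ → refl) (multiple p))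
  where
  multiple : ∀ q → SemiringMult._×_ (matrixSemiring n) q W ≈ + q ⊙ W
  multiple zero    i j = sym (ℤ.*-zeroˡ (W i j))
  multiple (suc q) i j = trans (cong (_+_ (W i j)) (multiple q i j)) (sym (ℤ.suc-* (+ q) (W i j)))

-- Equivalently, the matrix sends the all-ones vector to s times an all-ones vector, which is why
-- row sums multiply under products.
RowSum : ∀ {m n} → ℤ → Matrix m n → Set
RowSum s X = ∀ i → sum (X i) ≡ s

RowSum-cong : ∀ {m n s} {X Y : Matrix m n} → X ≈ Y → RowSum s X → RowSum s Y
RowSum-cong h r i = trans (sum-cong-≗ λ j → sym (h i j)) (r i)

RowSum-⊕ : ∀ {m n s t} {X Y : Matrix m n} → RowSum s X → RowSum t Y → RowSum (s + t) (X ⊕ Y)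
RowSum-⊕ {X = X} {Y} r q i = trans (∑-distrib-+ (X i) (Y i)) (cong₂ _+_ (r i) (q i))

RowSum-⊙ : ∀ {m n s} a {X : Matrix m n} → RowSum s X → RowSum (a * s) (a ⊙ X)
RowSum-⊙ a {X} r i = trans (sym (*-distribˡ-sum a (X i))) (cong (a *_) (r i))

RowSum-δ : ∀ {n} → RowSum (+ 1) (δ {n})
RowSum-δ {n} i = trans (sum-cong-≗ λ j → sym (ℤ.*-identityʳ (δ i j))) (sum-δˡ i λ _ → + 1)

RowSum-· : ∀ {l m n s t} {X : Matrix l m} {Y : Matrix m n} → RowSum s X → RowSum t Y → RowSum (s * t) (X · Y)
RowSum-· {s = s} {t} {X} {Y} r q i = begin
  sum (λ j → sum λ k → X i k * Y k j)   ≡⟨ ∑-comm (λ j k → X i k * Y k j) ⟩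
  sum (λ k → sum λ j → X i k * Y k j)
    ≡⟨ sum-cong-≗ (λ k → trans (sym (*-distribˡ-sum (X i k) (Y k))) (cong (X i k *_) (q k))) ⟩
  sum (λ k → X i k * t)                 ≡⟨ *-distribʳ-sum t (X i) ⟨
  sum (X i) * t                         ≡⟨ cong (_* t) (r i) ⟩
  s * t                                 ∎
  where open ≡-Reasoning

RowSum-^ᴹ : ∀ {n s} {X : Matrix n n} → RowSum s X → ∀ k → RowSum (s ^ k) (X ^ᴹ k)
RowSum-^ᴹ r zero    = RowSum-δ
RowSum-^ᴹ {X = X} r (suc k) = RowSum-· {X = X} {X ^ᴹ k} r (RowSum-^ᴹ {X = X} r k)

sum-permute : ∀ {n} (f : Fin n → ℤ) (σ τ : Fin n → Fin n) → (∀ i → σ (τ i) ≡ i) → (∀ i → τ (σ i) ≡ i) →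
              sum f ≡ sum (f ∘ σ)
sum-permute f σ τ στ τσ = SemiringSum.sum-permute ℤ-semiring f
  (Permutation.permutation σ τ στ τσ)

-- Matrices invariant under an abelian group of translations

-- The congruence of X^p with s times the identity modulo p. The quotient is kept as data because it
-- becomes the base of a further fibered matrix.
record CongruentPower (p : ℕ) {n} (s : ℤ) (X : Matrix n n) : Set where
  constructor congruentPower
  field
    quotient : Matrix n n
    power    : X ^ᴹ p ≈ scalar s ⊕ + p ⊙ quotient

open CongruentPower

CongruentPower-⊕ : ∀ {p n s t} {X Y : Matrix n n} → Prime p → X · Y ≈ Y · X →
                   CongruentPower p s X → CongruentPower p t Y → CongruentPower p (s + t) (X ⊕ Y)
CongruentPower-⊕ {p} {n} {s} {t} {X} {Y} pp XY≈YX x y with freshman's-dreamᴹ pp X Y XY≈YX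
... | W , h = congruentPower (quotient x ⊕ quotient y ⊕ W) λ i j → trans (h i j)
  (trans (cong₂ (λ a b → a + b + + p * W i j) (power x i j) (power y i j))
         (regroup s t (δ i j) (+ p) (quotient x i j) (quotient y i j) (W i j)))
  where
  regroup : ∀ s t d p x y w → s * d + p * x + (t * d + p * y) + p * w ≡ (s + t) * d + p * (x + y + w)
  regroup = solve-∀

CongruentPower-⊖ : ∀ {p n s t} {D X Y : Matrix n n} → Prime p → X ≈ D ⊕ Y → D · Y ≈ Y · D →
                   CongruentPower p s X → CongruentPower p t Y → CongruentPower p (s - t) D
CongruentPower-⊖ {p} {n} {s} {t} {D} {X} {Y} pp X≈D+Y DY≈YD x y with freshman's-dreamᴹ pp D Y DY≈YD
... | W , h = congruentPower (λ i j → quotient x i j - quotient y i j - W i j) λ i j → begin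
  (D ^ᴹ p) i j
    ≡⟨ isolate ((D ^ᴹ p) i j) ((Y ^ᴹ p) i j) (+ p * W i j) ⟩
  (D ^ᴹ p) i j + (Y ^ᴹ p) i j + + p * W i j - (Y ^ᴹ p) i j - + p * W i j
    ≡⟨ cong (λ z → z - (Y ^ᴹ p) i j - + p * W i j) (h i j) ⟨
  ((D ⊕ Y) ^ᴹ p) i j - (Y ^ᴹ p) i j - + p * W i j
    ≡⟨ cong (λ z → z - (Y ^ᴹ p) i j - + p * W i j) (^ᴹ-cong p X≈D+Y i j) ⟨
  (X ^ᴹ p) i j - (Y ^ᴹ p) i j - + p * W i j
    ≡⟨ cong₂ (λ a b → a - b - + p * W i j) (power x i j) (power y i j) ⟩
  s * δ i j + + p * quotient x i j - (t * δ i j + + p * quotient y i j) - + p * W i j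
    ≡⟨ regroup s t (δ i j) (+ p) (quotient x i j) (quotient y i j) (W i j) ⟩
  (s - t) * δ i j + + p * (quotient x i j - quotient y i j - W i j) ∎
  where
  open ≡-Reasoning
  isolate : ∀ d y w → d ≡ d + y + w - y - w
  isolate = solve-∀
  regroup : ∀ s t d p x y w → s * d + p * x - (t * d + p * y) - p * w ≡ (s - t) * d + p * (x - y - w)
  regroup = solve-∀

module Translation {n} {_∙_ : Fin n → Fin n → Fin n} {ε : Fin n} {_⁻¹ : Fin n → Fin n}
                   (isAbelianGroup : IsAbelianGroup _≡_ _∙_ ε _⁻¹) where

  open IsAbelianGroup isAbelianGroup using (assoc; comm; identityˡ; identityʳ; inverseˡ; inverseʳ)

  cancelˡ-inverse : ∀ g i → (g ⁻¹) ∙ (g ∙ i) ≡ i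
  cancelˡ-inverse g i = trans (sym (assoc (g ⁻¹) g i)) (trans (cong (_∙ i) (inverseˡ g)) (identityˡ i))

  cancelˡ-inverse′ : ∀ g i → g ∙ ((g ⁻¹) ∙ i) ≡ i
  cancelˡ-inverse′ g i = trans (sym (assoc g (g ⁻¹) i)) (trans (cong (_∙ i) (inverseʳ g)) (identityˡ i))

  ∙-cancelˡ : ∀ g {i j} → g ∙ i ≡ g ∙ j → i ≡ j
  ∙-cancelˡ g {i} {j} h = trans (sym (cancelˡ-inverse g i)) (trans (cong ((g ⁻¹) ∙_) h) (cancelˡ-inverse g j))

  sum-translate : ∀ g (f : Fin n → ℤ) → sum f ≡ sum (λ i → f (g ∙ i))
  sum-translate g f = sum-permute f (g ∙_) ((g ⁻¹) ∙_) (cancelˡ-inverse′ g) (cancelˡ-inverse g)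

  -- These are the matrices of group ring elements: the entry at (i, j) depends only on the ratio of
  -- i and j.
  Invariant : Matrix n n → Set
  Invariant X = ∀ g i j → X (g ∙ i) (g ∙ j) ≡ X i j

  invariant-≈ : ∀ {X Y} → X ≈ Y → Invariant X → Invariant Y
  invariant-≈ h x g i j = trans (sym (h (g ∙ i) (g ∙ j))) (trans (x g i j) (h i j))

  invariant-⊕ : ∀ {X Y} → Invariant X → Invariant Y → Invariant (X ⊕ Y)
  invariant-⊕ x y g i j = cong₂ _+_ (x g i j) (y g i j)

  invariant-⊙ : ∀ a {X} → Invariant X → Invariant (a ⊙ X)
  invariant-⊙ a x g i j = cong (a *_) (x g i j)

  invariant-δ : Invariant δ
  invariant-δ g i j = δ-cong-⇔ (∙-cancelˡ g) (cong (g ∙_))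

  invariant-· : ∀ {X Y} → Invariant X → Invariant Y → Invariant (X · Y)
  invariant-· {X} {Y} x y g i j = trans (sum-translate g λ k → X (g ∙ i) k * Y k (g ∙ j))
    (sum-cong-≗ λ k → cong₂ _*_ (x g i k) (y g k j))

  invariant-^ᴹ : ∀ {X} → Invariant X → ∀ k → Invariant (X ^ᴹ k)
  invariant-^ᴹ x zero    = invariant-δ
  invariant-^ᴹ {X} x (suc k) = invariant-· {X} {X ^ᴹ k} x (invariant-^ᴹ x k)

  -- The hypothesis says that i/l = k/j; translating one entry by k and the other by i makes them
  -- coincide.
  invariant-ratio : ∀ {X} → Invariant X → ∀ {i j k l} → i ∙ j ≡ k ∙ l → X i l ≡ X k j
  invariant-ratio {X} x {i} {j} {k} {l} h = begin
    X i l              ≡⟨ x k i l ⟨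
    X (k ∙ i) (k ∙ l)  ≡⟨ cong₂ X (comm k i) (sym h) ⟩
    X (i ∙ k) (i ∙ j)  ≡⟨ x i k j ⟩
    X k j              ∎
    where open ≡-Reasoning

  -- The involution sending k to ij/k turns `X i k * Y k j` into `X k j * Y i k`.
  commute : ∀ {X Y} → Invariant X → Invariant Y → X · Y ≈ Y · X
  commute {X} {Y} x y i j = trans (sum-permute (λ k → X i k * Y k j) φ φ φφ φφ)
    (sum-cong-≗ λ k → trans (cong₂ _*_ (invariant-ratio x (sym (φ-∙ k)))
                                       (sym (invariant-ratio y (trans (sym (φ-∙ k)) (comm k (φ k))))))
                            (ℤ.*-comm (X k j) (Y i k)))
    where
    φ : Fin n → Fin n
    φ k = (k ⁻¹) ∙ (i ∙ j)
    φ-∙ : ∀ k → k ∙ φ k ≡ i ∙ j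
    φ-∙ k = cancelˡ-inverse′ k (i ∙ j)
    φφ : ∀ k → φ (φ k) ≡ k
    φφ k = ∙-cancelˡ (φ k) (trans (φ-∙ (φ k)) (trans (sym (φ-∙ k)) (comm k (φ k))))

  -- Multiplied by q, the quotient is X^q minus a scalar matrix, which is invariant; entrywise
  -- cancellation of q does the rest.
  quotient-invariant : ∀ {q s X} .{{_ : NonZero q}} → Invariant X → (c : CongruentPower q s X) →
                       Invariant (quotient c)
  quotient-invariant {q} {s} {X} x c g i j = ℤ.*-cancelˡ-≡ (+ q) _ _ (begin
    + q * quotient c (g ∙ i) (g ∙ j)               ≡⟨ solved (g ∙ i) (g ∙ j) ⟩
    (X ^ᴹ q) (g ∙ i) (g ∙ j) - s * δ (g ∙ i) (g ∙ j)
      ≡⟨ cong₂ (λ y d → y - s * d) (invariant-^ᴹ x q g i j) (invariant-δ g i j) ⟩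
    (X ^ᴹ q) i j - s * δ i j                       ≡⟨ solved i j ⟨
    + q * quotient c i j                           ∎)
    where
    open ≡-Reasoning
    cancel : ∀ d r → r ≡ d + r - d
    cancel = solve-∀
    solved : ∀ k l → + q * quotient c k l ≡ (X ^ᴹ q) k l - s * δ k l
    solved k l = trans (cancel (s * δ k l) (+ q * quotient c k l)) (cong (_- s * δ k l) (sym (power c k l)))

  -- The regular representation: the permutation matrix of translation by `g`.
  P : Fin n → Matrix n n
  P g i j = δ i (g ∙ j)

  P-invariant : ∀ g → Invariant (P g)
  P-invariant g h i j = trans (cong (δ (h ∙ i)) swap) (invariant-δ h i (g ∙ j))
    where
    swap : g ∙ (h ∙ j) ≡ h ∙ (g ∙ j)
    swap = trans (sym (assoc g h j)) (trans (cong (_∙ j) (comm g h)) (assoc h g j))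

  P-∙ : ∀ g h → P g · P h ≈ P (g ∙ h)
  P-∙ g h i j = trans (sum-δʳ (h ∙ j) (λ k → δ i (g ∙ k))) (cong (δ i) (sym (assoc g h j)))

  P-ε : P ε ≈ δ
  P-ε i j = cong (δ i) (identityˡ j)

  P-rowSum : ∀ g → RowSum (+ 1) (P g)
  P-rowSum g i = trans (sym (sum-translate g (δ i))) (RowSum-δ i)

  pow : Fin n → ℕ → Fin n
  pow g zero    = ε
  pow g (suc k) = g ∙ pow g k

  P-^ᴹ : ∀ g k → P g ^ᴹ k ≈ P (pow g k)
  P-^ᴹ g zero    = ≈-sym P-ε
  P-^ᴹ g (suc k) = ≈-trans (·-cong {M = P g} (λ _ _ → refl) (P-^ᴹ g k)) (P-∙ g (pow g k))

  -- At the entry (i, j) only the ratio g = i/j contributes. The column of `ε` thus holds the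
  -- coefficients of the group ring element.
  decompose : ∀ {X} → Invariant X → X ≈ λ i j → sum λ g → X g ε * P g i j
  decompose {X} x i j = sym (begin
    sum (λ g → X g ε * δ i (g ∙ j))     ≡⟨ sum-cong-≗ (λ g → cong (X g ε *_) (δ-cong-⇔ to from)) ⟩
    sum (λ g → X g ε * δ g ((j ⁻¹) ∙ i)) ≡⟨ sum-δʳ ((j ⁻¹) ∙ i) (λ g → X g ε) ⟩
    X ((j ⁻¹) ∙ i) ε                    ≡⟨ invariant-ratio x (trans (comm _ j)
                                             (trans (cancelˡ-inverse′ j i) (sym (identityʳ i)))) ⟩
    X i j                               ∎)
    where
    open ≡-Reasoning
    to : ∀ {g} → i ≡ g ∙ j → g ≡ (j ⁻¹) ∙ i
    to {g} refl = sym (trans (cong ((j ⁻¹) ∙_) (comm g j)) (cancelˡ-inverse j g))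
    from : ∀ {g} → g ≡ (j ⁻¹) ∙ i → i ≡ g ∙ j
    from refl = sym (trans (comm _ j) (cancelˡ-inverse′ j i))

  -- The involution sending k to i/k carries row `i` to the column of `ε`.
  rowSum : ∀ {X} → Invariant X → RowSum (sum λ g → X g ε) X
  rowSum {X} x i = trans (sum-permute (X i) (λ k → (k ⁻¹) ∙ i) (λ k → (k ⁻¹) ∙ i) invol invol)
    (sum-cong-≗ λ k → invariant-ratio x (trans (identityʳ i) (sym (cancelˡ-inverse′ k i))))
    where
    invol : ∀ k → (((k ⁻¹) ∙ i) ⁻¹) ∙ i ≡ k
    invol k = ∙-cancelˡ ((k ⁻¹) ∙ i) (trans (cancelˡ-inverse′ _ i)
                (trans (sym (cancelˡ-inverse′ k i)) (comm k ((k ⁻¹) ∙ i))))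

  -- The Frobenius congruence (Σ a_g g)^p ≡ Σ a_g g^p = Σ a_g (mod p) in the group ring.
  module _ {p} (pp : Prime p) (exponent : ∀ g → pow g p ≡ ε) where

    private
      Good : ℤ → Matrix n n → Set
      Good s X = Invariant X × CongruentPower p s X

      good-≈ : ∀ {s t X Y} → s ≡ t → X ≈ Y → Good s X → Good t Y
      good-≈ refl h (x , c) = invariant-≈ h x ,
        congruentPower (quotient c) (≈-trans (^ᴹ-cong p (≈-sym h)) (power c))

      good-⊕ : ∀ {s t X Y} → Good s X → Good t Y → Good (s + t) (X ⊕ Y)
      good-⊕ (x , c) (y , d) = invariant-⊕ x y , CongruentPower-⊕ pp (commute x y) c d

      good-P : ∀ g → Good (+ 1) (P g)
      good-P g = P-invariant g , congruentPower O λ i j → begin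
        (P g ^ᴹ p) i j               ≡⟨ P-^ᴹ g p i j ⟩
        P (pow g p) i j              ≡⟨ cong (λ h → P h i j) (exponent g) ⟩
        P ε i j                      ≡⟨ P-ε i j ⟩
        δ i j                        ≡⟨ simplify (δ i j) (+ p) ⟩
        + 1 * δ i j + + p * (+ 0)    ∎
        where
        open ≡-Reasoning
        simplify : ∀ d p → d ≡ + 1 * d + p * (+ 0)
        simplify = solve-∀

      -- Obtained as `P ε` minus itself, so that the p-th power of zero need not be computed.
      good-O : Good (+ 0) O
      good-O = (λ _ _ _ → refl) , CongruentPower-⊖ {D = O} {X = P ε} {Y = P ε} pp
        (λ i j → sym (ℤ.+-identityˡ _)) (≈-trans (·-zeroˡ (P ε)) (≈-sym (·-zeroʳ (P ε))))
        (proj₂ (good-P ε)) (proj₂ (good-P ε))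

      -- The coefficient is built up by repeated addition, so the congruence of k^p and k modulo p
      -- is a consequence and not an input.
      good-natural : ∀ k g → Good (+ k) (+ k ⊙ P g)
      good-natural zero    g = good-≈ refl (λ i j → sym (ℤ.*-zeroˡ (P g i j))) good-O
      good-natural (suc k) g = good-≈ refl (λ i j → sym (ℤ.suc-* (+ k) (P g i j)))
        (good-⊕ (good-P g) (good-natural k g))

      good-integer : ∀ a g → Good a (a ⊙ P g)
      good-integer (+ k)      g = good-natural k g
      good-integer -[1+ k ]   g = invariant-⊙ -[1+ k ] (P-invariant g) ,
        subst (λ a → CongruentPower p a (-[1+ k ] ⊙ P g)) (ℤ.+-identityˡ -[1+ k ])
          (CongruentPower-⊖ pp (λ i j → cancel -[1+ k ] (P g i j))
            (commute (invariant-⊙ -[1+ k ] (P-invariant g)) (invariant-⊙ (- -[1+ k ]) (P-invariant g)))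
            (proj₂ good-O) (proj₂ (good-natural (suc k) g)))
        where
        cancel : ∀ a x → + 0 ≡ a * x + - a * x
        cancel = solve-∀

      good-sum : ∀ {k} (c : Fin k → ℤ) (w : Fin k → Fin n) →
                 Good (sum c) (λ i j → sum λ l → c l * P (w l) i j)
      good-sum {zero}  c w = good-O
      good-sum {suc k} c w = good-⊕ (good-integer (c zero) (w zero)) (good-sum (c ∘ suc) (w ∘ suc))

    frobenius : ∀ {X} → Invariant X → CongruentPower p (sum λ g → X g ε) X
    frobenius {X} x = proj₂ (good-≈ refl (≈-sym (decompose x)) (good-sum (λ g → X g ε) id))

-- Cyclic groups and products of groups

ι : ∀ {n} → Fin n → ℤ
ι i = + toℕ i

-- Two residues lie at distance less than p, and a multiple of p that small is zero.
ι-congruent : ∀ {p} (i j : Fin p) k → ι i ≡ ι j + k * + p → i ≡ j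
ι-congruent {p} i j k h = Fin.toℕ-injective (ℤ.+-injective (ℤ.i-j≡0⇒i≡j _ _ (ℤ.∣i∣≡0⇒i≡0 distance≡0)))
  where
  open ≡-Reasoning
  cancel : ∀ y z → y + z - y ≡ z
  cancel = solve-∀
  difference : ι i - ι j ≡ k * + p
  difference = trans (cong (_- ι j) h) (cancel (ι j) (k * + p))
  p∣distance : p ∣ ∣ ι i - ι j ∣
  p∣distance = ℕ.divides ∣ k ∣ (trans (cong ∣_∣ difference) (ℤ.abs-* k (+ p)))
  distance<p : ∣ ι i - ι j ∣ < p
  distance<p = ℕ.≤-<-trans (subst (λ z → ∣ z ∣ ℕ.≤ toℕ i ℕ.⊔ toℕ j) (sym (ℤ.m-n≡m⊖n (toℕ i) (toℕ j)))
                              (ℤ.∣m⊝n∣≤m⊔n (toℕ i) (toℕ j)))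
                           (ℕ.⊔-lub (Fin.toℕ<n i) (Fin.toℕ<n j))
  distance≡0 : ∣ ι i - ι j ∣ ≡ 0
  distance≡0 with ∣ ι i - ι j ∣ | p∣distance | distance<p
  ... | zero  | _   | _   = refl
  ... | suc d | p∣d | d<p = contradiction p∣d (ℕ.>⇒∤ d<p)

module _ (p : ℕ) .{{_ : NonZero p}} where

  ι-modP : ∀ z → ∃ λ k → ι (modP p z) ≡ z + k * + p
  ι-modP z = - (z /ℕ p) , (begin
    ι (modP p z)                               ≡⟨ cong +_ (Fin.toℕ-fromℕ< (n%ℕd<d z p)) ⟩
    + (z %ℕ p)                                 ≡⟨ move (+ (z %ℕ p)) (z /ℕ p) (+ p) ⟩
    + (z %ℕ p) + (z /ℕ p) * + p + - (z /ℕ p) * + p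
      ≡⟨ cong (_+ - (z /ℕ p) * + p) (a≡a%ℕn+[a/ℕn]*n z p) ⟨
    z + - (z /ℕ p) * + p                       ∎)
    where
    open ≡-Reasoning
    move : ∀ r q p → r ≡ r + q * p + - q * p
    move = solve-∀

  modP-cong : ∀ x y k → x ≡ y + k * + p → modP p x ≡ modP p y
  modP-cong x y k h with ι-modP x | ι-modP y
  ... | k₁ , h₁ | k₂ , h₂ = ι-congruent (modP p x) (modP p y) (k + k₁ - k₂) (begin
    ι (modP p x)                              ≡⟨ trans h₁ (cong (_+ k₁ * + p) h) ⟩
    y + k * + p + k₁ * + p                    ≡⟨ regroup y k k₁ k₂ (+ p) ⟩
    y + k₂ * + p + (k + k₁ - k₂) * + p        ≡⟨ cong (_+ (k + k₁ - k₂) * + p) h₂ ⟨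
    ι (modP p y) + (k + k₁ - k₂) * + p        ∎)
    where
    open ≡-Reasoning
    regroup : ∀ y k k₁ k₂ p → y + k * p + k₁ * p ≡ y + k₂ * p + (k + k₁ - k₂) * p
    regroup = solve-∀

  modP-ι : ∀ i → modP p (ι i) ≡ i
  modP-ι i = let k , h = ι-modP (ι i) in ι-congruent (modP p (ι i)) i k h

  modP-≡ : ∀ z i k → z ≡ ι i + k * + p → modP p z ≡ i
  modP-≡ z i k h = trans (modP-cong z (ι i) k h) (modP-ι i)

  infixl 7 _∙ᶻ_
  _∙ᶻ_ : Fin p → Fin p → Fin p
  i ∙ᶻ j = modP p (ι i + ι j)

  infix 8 _⁻¹ᶻ
  _⁻¹ᶻ : Fin p → Fin p
  i ⁻¹ᶻ = modP p (- ι i)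

  modP-+ : ∀ x y → modP p x ∙ᶻ modP p y ≡ modP p (x + y)
  modP-+ x y with ι-modP x | ι-modP y
  ... | k , h | l , h′ = modP-cong _ (x + y) (k + l) (trans (cong₂ _+_ h h′) (regroup x y k l (+ p)))
    where
    regroup : ∀ x y k l p → x + k * p + (y + l * p) ≡ x + y + (k + l) * p
    regroup = solve-∀

  ∙ᶻ-comm : ∀ i j → i ∙ᶻ j ≡ j ∙ᶻ i
  ∙ᶻ-comm i j = cong (modP p) (ℤ.+-comm (ι i) (ι j))

  cyclic-isAbelianGroup : IsAbelianGroup _≡_ _∙ᶻ_ (modP p (+ 0)) _⁻¹ᶻ
  cyclic-isAbelianGroup = record
    { isGroup = record
      { isMonoid = record
        { isSemigroup = record
          { isMagma = record { isEquivalence = isEquivalence ; ∙-cong = cong₂ _∙ᶻ_ }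
          ; assoc = assoc }
        ; identity = identityˡ , λ i → trans (∙ᶻ-comm i (modP p (+ 0))) (identityˡ i) }
      ; inverse = inverseˡ , λ i → trans (∙ᶻ-comm i (i ⁻¹ᶻ)) (inverseˡ i)
      ; ⁻¹-cong = cong _⁻¹ᶻ }
    ; comm = ∙ᶻ-comm }
    where
    open ≡-Reasoning
    assoc : ∀ i j k → (i ∙ᶻ j) ∙ᶻ k ≡ i ∙ᶻ (j ∙ᶻ k)
    assoc i j k = begin
      (i ∙ᶻ j) ∙ᶻ k                          ≡⟨ cong ((i ∙ᶻ j) ∙ᶻ_) (modP-ι k) ⟨
      modP p (ι i + ι j) ∙ᶻ modP p (ι k)     ≡⟨ modP-+ (ι i + ι j) (ι k) ⟩
      modP p (ι i + ι j + ι k)               ≡⟨ cong (modP p) (ℤ.+-assoc (ι i) (ι j) (ι k)) ⟩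
      modP p (ι i + (ι j + ι k))             ≡⟨ modP-+ (ι i) (ι j + ι k) ⟨
      modP p (ι i) ∙ᶻ (j ∙ᶻ k)               ≡⟨ cong (_∙ᶻ (j ∙ᶻ k)) (modP-ι i) ⟩
      i ∙ᶻ (j ∙ᶻ k)                          ∎
    identityˡ : ∀ i → modP p (+ 0) ∙ᶻ i ≡ i
    identityˡ i = begin
      modP p (+ 0) ∙ᶻ i                ≡⟨ cong (modP p (+ 0) ∙ᶻ_) (modP-ι i) ⟨
      modP p (+ 0) ∙ᶻ modP p (ι i)     ≡⟨ modP-+ (+ 0) (ι i) ⟩
      modP p (+ 0 + ι i)               ≡⟨ cong (modP p) (ℤ.+-identityˡ (ι i)) ⟩
      modP p (ι i)                     ≡⟨ modP-ι i ⟩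
      i                                ∎
    inverseˡ : ∀ i → i ⁻¹ᶻ ∙ᶻ i ≡ modP p (+ 0)
    inverseˡ i = begin
      i ⁻¹ᶻ ∙ᶻ i                       ≡⟨ cong (i ⁻¹ᶻ ∙ᶻ_) (modP-ι i) ⟨
      modP p (- ι i) ∙ᶻ modP p (ι i)   ≡⟨ modP-+ (- ι i) (ι i) ⟩
      modP p (- ι i + ι i)             ≡⟨ cong (modP p) (ℤ.+-inverseˡ (ι i)) ⟩
      modP p (+ 0)                     ∎

  module Cyclic = Translation cyclic-isAbelianGroup

  cyclic-pow : ∀ g k → Cyclic.pow g k ≡ modP p (+ k * ι g)
  cyclic-pow g zero    = cong (modP p) (sym (ℤ.*-zeroˡ (ι g)))
  cyclic-pow g (suc k) = begin
    g ∙ᶻ Cyclic.pow g k                  ≡⟨ cong₂ _∙ᶻ_ (sym (modP-ι g)) (cyclic-pow g k) ⟩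
    modP p (ι g) ∙ᶻ modP p (+ k * ι g)   ≡⟨ modP-+ (ι g) (+ k * ι g) ⟩
    modP p (ι g + + k * ι g)             ≡⟨ cong (modP p) (ℤ.suc-* (+ k) (ι g)) ⟨
    modP p (+ suc k * ι g)               ∎
    where open ≡-Reasoning

  cyclic-exponent : ∀ g → Cyclic.pow g p ≡ modP p (+ 0)
  cyclic-exponent g = trans (cyclic-pow g p) (modP-cong _ (+ 0) (ι g)
    (trans (ℤ.*-comm (+ p) (ι g)) (sym (ℤ.+-identityˡ (ι g * + p)))))

module ProductGroup
  {m n} {_∙₁_ : Fin m → Fin m → Fin m} {ε₁ : Fin m} {_⁻¹₁ : Fin m → Fin m}
  {_∙₂_ : Fin n → Fin n → Fin n} {ε₂ : Fin n} {_⁻¹₂ : Fin n → Fin n}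
  (G : IsAbelianGroup _≡_ _∙₁_ ε₁ _⁻¹₁) (H : IsAbelianGroup _≡_ _∙₂_ ε₂ _⁻¹₂) where

  private
    module G = IsAbelianGroup G
    module H = IsAbelianGroup H

  fst : Fin (m ℕ.* n) → Fin m
  fst i = proj₁ (remQuot {m} n i)

  snd : Fin (m ℕ.* n) → Fin n
  snd i = proj₂ (remQuot {m} n i)

  fst-combine : ∀ i j → fst (combine i j) ≡ i
  fst-combine i j = cong proj₁ (Fin.remQuot-combine i j)

  snd-combine : ∀ i j → snd (combine {m} i j) ≡ j
  snd-combine i j = cong proj₂ (Fin.remQuot-combine {m} i j)

  infixl 7 _∙_
  _∙_ : Fin (m ℕ.* n) → Fin (m ℕ.* n) → Fin (m ℕ.* n)
  i ∙ j = combine (fst i ∙₁ fst j) (snd i ∙₂ snd j)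

  ε : Fin (m ℕ.* n)
  ε = combine ε₁ ε₂

  infix 8 _⁻¹
  _⁻¹ : Fin (m ℕ.* n) → Fin (m ℕ.* n)
  i ⁻¹ = combine (fst i ⁻¹₁) (snd i ⁻¹₂)

  combine-≡ : ∀ {k l} i → k ≡ fst i → l ≡ snd i → combine k l ≡ i
  combine-≡ i refl refl = Fin.combine-remQuot {m} n i

  product-isAbelianGroup : IsAbelianGroup _≡_ _∙_ ε _⁻¹
  product-isAbelianGroup = record
    { isGroup = record
      { isMonoid = record
        { isSemigroup = record
          { isMagma = record { isEquivalence = isEquivalence ; ∙-cong = cong₂ _∙_ }
          ; assoc = λ i j k → cong₂ combine
              (trans (cong (_∙₁ fst k) (fst-combine _ _)) (trans (G.assoc (fst i) (fst j) (fst k))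
                (cong (fst i ∙₁_) (sym (fst-combine _ (snd j ∙₂ snd k))))))
              (trans (cong (_∙₂ snd k) (snd-combine (fst i ∙₁ fst j) _)) (trans (H.assoc (snd i) (snd j) (snd k))
                (cong (snd i ∙₂_) (sym (snd-combine (fst j ∙₁ fst k) _))))) }
        ; identity = (λ i → combine-≡ i
              (trans (cong (_∙₁ fst i) (fst-combine ε₁ ε₂)) (G.identityˡ (fst i)))
              (trans (cong (_∙₂ snd i) (snd-combine ε₁ ε₂)) (H.identityˡ (snd i))))
          , λ i → combine-≡ i
              (trans (cong (fst i ∙₁_) (fst-combine ε₁ ε₂)) (G.identityʳ (fst i)))
              (trans (cong (snd i ∙₂_) (snd-combine ε₁ ε₂)) (H.identityʳ (snd i))) }
      ; inverse = (λ i → cong₂ combine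
              (trans (cong (_∙₁ fst i) (fst-combine (fst i ⁻¹₁) (snd i ⁻¹₂))) (G.inverseˡ (fst i)))
              (trans (cong (_∙₂ snd i) (snd-combine (fst i ⁻¹₁) (snd i ⁻¹₂))) (H.inverseˡ (snd i))))
          , λ i → cong₂ combine
              (trans (cong (fst i ∙₁_) (fst-combine (fst i ⁻¹₁) (snd i ⁻¹₂))) (G.inverseʳ (fst i)))
              (trans (cong (snd i ∙₂_) (snd-combine (fst i ⁻¹₁) (snd i ⁻¹₂))) (H.inverseʳ (snd i)))
      ; ⁻¹-cong = cong _⁻¹ }
    ; comm = λ i j → cong₂ combine (G.comm (fst i) (fst j)) (H.comm (snd i) (snd j)) }

  module Product = Translation product-isAbelianGroup
  module First = Translation G
  module Second = Translation H

  product-pow : ∀ g k → Product.pow g k ≡ combine (First.pow (fst g) k) (Second.pow (snd g) k)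
  product-pow g zero    = refl
  product-pow g (suc k) = cong₂ (λ a b → combine (fst g ∙₁ a) (snd g ∙₂ b))
    (trans (cong fst (product-pow g k)) (fst-combine _ _))
    (trans (cong snd (product-pow g k)) (snd-combine (First.pow (fst g) k) _))

  fibered-invariant : ∀ {B : Matrix m m} {C : Matrix n n} → First.Invariant B → Second.Invariant C →
                      Product.Invariant (fibered B C)
  fibered-invariant {B} {C} b c g i j = begin
    fiberedEntry B C (remQuot {m} n (g ∙ i)) (remQuot {m} n (g ∙ j))
      ≡⟨ cong₂ (fiberedEntry B C) (Fin.remQuot-combine _ _) (Fin.remQuot-combine _ _) ⟩
    δ (fst g ∙₁ fst i) (fst g ∙₁ fst j) * C (snd g ∙₂ snd i) (snd g ∙₂ snd j) +
      B (fst g ∙₁ fst i) (fst g ∙₁ fst j)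
      ≡⟨ cong₂ _+_ (cong₂ _*_ (First.invariant-δ (fst g) (fst i) (fst j)) (c (snd g) (snd i) (snd j)))
                   (b (fst g) (fst i) (fst j)) ⟩
    fibered B C i j ∎
    where open ≡-Reasoning

-- Circulants

J : ∀ {m n} → Matrix m n
J i j = + 1

·-J : ∀ {l m n s} {X : Matrix l m} → RowSum s X → X · J {m} {n} ≈ s ⊙ J
·-J {s = s} {X} r i j = trans (sum-cong-≗ λ k → ℤ.*-identityʳ (X i k)) (trans (r i) (sym (ℤ.*-identityʳ s)))

RowSum-J : ∀ {m n} → RowSum (+ n) (J {m} {n})
RowSum-J {m} {n} i = trans (sum-constant n (+ 1)) (ℤ.*-identityʳ (+ n))

·-⊙ : ∀ {l m n} (M : Matrix l m) a (N : Matrix m n) → M · (a ⊙ N) ≈ a ⊙ (M · N)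
·-⊙ M a N i j = trans (sum-cong-≗ λ k → swap (M i k) a (N k j)) (sym (*-distribˡ-sum a λ k → M i k * N k j))
  where
  swap : ∀ x a y → x * (a * y) ≡ a * (x * y)
  swap = solve-∀

-- The rank-one case of `det-update`: c times `J` is a column of ones times a row of c's, the column
-- is an eigenvector of `K`, and the small determinant is the single number s + nc.
det-⊕-J : ∀ {n} s c (K : Matrix n n) → RowSum s K → det (K ⊕ c ⊙ J) * s ≡ det K * (s + + n * c)
det-⊕-J {n} s c K r = begin
  det (K ⊕ c ⊙ J) * s         ≡⟨ cong₂ _*_ (det-cong {N = K ⊕ c ⊙ J} outer) (ℤ.*-identityʳ s) ⟨
  det (K ⊕ col · row) * s ^ 1 ≡⟨ det-update {n} {1} s K col row (·-J {X = K} r) ⟩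
  det K * det small           ≡⟨ cong (det K *_) (simplify (small zero zero)) ⟩
  det K * small zero zero     ≡⟨ cong (det K *_) (cong₂ _+_ (ℤ.*-identityʳ s) inner) ⟩
  det K * (s + + n * c)       ∎
  where
  open ≡-Reasoning
  col : Matrix n 1
  col = J
  row : Matrix 1 n
  row = c ⊙ J
  small : Matrix 1 1
  small = scalar s ⊕ row · col
  simplify : ∀ x → + 1 * x * + 1 + + 0 ≡ x
  simplify = solve-∀
  outer : K ⊕ col · row ≈ K ⊕ c ⊙ J
  outer i j = cong (_+_ (K i j)) (trans (ℤ.+-identityʳ (+ 1 * (c * + 1))) (ℤ.*-identityˡ (c * + 1)))
  inner : (row · col) zero zero ≡ + n * c
  inner = trans (sum-constant n (c * + 1 * + 1))
    (cong (+ n *_) (trans (ℤ.*-identityʳ (c * + 1)) (ℤ.*-identityʳ c)))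

-- Relabelling is conjugation by the permutation matrix `Q` of `σ`. Injectivity gives that
-- `Q · (Q ᵀ)` is the identity, so the sign of the permutation never has to be found.
det-relabel : ∀ {n} {σ : Fin n → Fin n} → (∀ {i j} → σ i ≡ σ j → i ≡ j) → (M : Matrix n n) →
              det (λ i j → M (σ i) (σ j)) ≡ det M
det-relabel {n} {σ} injective M = begin
  det (λ i j → M (σ i) (σ j))       ≡⟨ det-cong (λ i j → sym (entry i j)) ⟩
  det (Q · M · (Q ᵀ))               ≡⟨ det-· (Q · M) (Q ᵀ) ⟩
  det (Q · M) * det (Q ᵀ)           ≡⟨ cong (_* det (Q ᵀ)) (det-· Q M) ⟩
  det Q * det M * det (Q ᵀ)         ≡⟨ swap (det Q) (det M) (det (Q ᵀ)) ⟩
  det Q * det (Q ᵀ) * det M         ≡⟨ cong (_* det M) (det-· Q (Q ᵀ)) ⟨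
  det (Q · (Q ᵀ)) * det M
    ≡⟨ cong (_* det M) (trans (det-cong {N = δ} orthogonal) (det-δ n)) ⟩
  + 1 * det M                       ≡⟨ ℤ.*-identityˡ (det M) ⟩
  det M                             ∎
  where
  open ≡-Reasoning
  Q : Matrix n n
  Q i k = δ (σ i) k
  swap : ∀ x y z → x * y * z ≡ x * z * y
  swap = solve-∀
  entry : ∀ i j → (Q · M · (Q ᵀ)) i j ≡ M (σ i) (σ j)
  entry i j = trans (sum-cong-≗ λ k → cong₂ _*_ (sum-δˡ (σ i) λ l → M l k) (δ-sym (σ j) k))
                    (sum-δʳ (σ j) (M (σ i)))
  orthogonal : Q · (Q ᵀ) ≈ δ
  orthogonal i j = trans (sum-δˡ (σ i) (λ k → δ (σ j) k))
                         (δ-cong-⇔ (sym ∘ injective) (cong σ ∘ sym))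

^-nonZero : ∀ i n .{{_ : ℤ.NonZero i}} → ℤ.NonZero (i ^ n)
^-nonZero i zero    = _
^-nonZero i (suc n) {{i≢0}} = ℤ.i*j≢0 i (i ^ n) {{i≢0}} {{^-nonZero i n}}

module Circulant (p : ℕ) .{{_ : NonZero p}} where

  open Cyclic p

  private
    infixl 7 _∙ᶻ′_
    _∙ᶻ′_ : Fin p → Fin p → Fin p
    _∙ᶻ′_ = _∙ᶻ_ p

  -- The power x^z of the cyclic shift x.
  R : ℤ → Matrix p p
  R z = P (modP p z)

  R-+ : ∀ x y → R x · R y ≈ R (x + y)
  R-+ x y = ≈-trans (P-∙ (modP p x) (modP p y)) (λ i j → cong (λ g → P g i j) (modP-+ p x y))

  R-p : R (+ p) ≈ δ
  R-p = ≈-trans (λ i j → cong (λ g → P g i j) (modP-cong p (+ p) (+ 0) (+ 1) refl-p)) P-ε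
    where
    refl-p : + p ≡ + 0 + + 1 * + p
    refl-p = trans (sym (ℤ.*-identityˡ (+ p))) (sym (ℤ.+-identityˡ (+ 1 * + p)))

  -- The circulant of x - 1, against which geometric sums telescope.
  D : Matrix p p
  D = R (+ 1) ⊕ - + 1 ⊙ δ

  D-invariant : Invariant D
  D-invariant = invariant-⊕ (P-invariant (modP p (+ 1))) (invariant-⊙ (- + 1) invariant-δ)

  D-rowSum : RowSum (+ 0) D
  D-rowSum = RowSum-⊕ {X = R (+ 1)} { - + 1 ⊙ δ} (P-rowSum (modP p (+ 1))) (RowSum-⊙ (- + 1) {δ} RowSum-δ)

  J-invariant : Invariant J
  J-invariant _ _ _ = refl

  D-R : ∀ k → D · R (+ k) ≈ R (+ suc k) ⊕ - + 1 ⊙ R (+ k)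
  D-R k = ≈-trans (·-⊕-distribʳ (R (+ k)) (R (+ 1)) (- + 1 ⊙ δ))
    (⊕-cong (R-+ (+ 1) (+ k)) (≈-trans (⊙-· (- + 1) δ (R (+ k))) λ i j → cong (- + 1 *_) (·-identityˡ (R (+ k)) i j)))

  weighted : (ℕ → ℤ) → ℕ → Matrix p p
  weighted c k i j = sum {k} λ l → c (toℕ l) * R (ι l) i j

  weighted-suc : ∀ c k → weighted c (suc k) ≈ weighted c k ⊕ c k ⊙ R (+ k)
  weighted-suc c k i j = trans
    (sum-init-last (term {suc k}))
    (cong₂ _+_ (sum-cong-≗ {k} λ l → cong (λ n → c n * R (+ n) i j) (Fin.toℕ-inject₁ l))
               (cong (λ n → c n * R (+ n) i j) (Fin.toℕ-fromℕ k)))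
    where
    term : ∀ {n} → Fin n → ℤ
    term l = c (toℕ l) * R (ι l) i j

  weighted-invariant : ∀ c k → Invariant (weighted c k)
  weighted-invariant c k g i j = sum-cong-≗ {k} λ l → cong (c (toℕ l) *_) (P-invariant (modP p (ι l)) g i j)

  geometric : ℕ → Matrix p p
  geometric = weighted λ _ → + 1

  geometric-rowSum : ∀ k → RowSum (+ k) (geometric k)
  geometric-rowSum zero    = λ i → sum-zero {p} λ _ → refl
  geometric-rowSum (suc k) = RowSum-cong {X = geometric k ⊕ + 1 ⊙ R (+ k)} (≈-sym (weighted-suc (λ _ → + 1) k))
    λ i → trans (RowSum-⊕ {X = geometric k} {+ 1 ⊙ R (+ k)} (geometric-rowSum k)
                  (RowSum-⊙ (+ 1) {R (+ k)} (P-rowSum (modP p (+ k)))) i)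
                (ℤ.+-comm (+ k) (+ 1))

  D-geometric : ∀ k → D · geometric k ≈ R (+ k) ⊕ - + 1 ⊙ δ
  D-geometric zero    i j = trans (·-zeroʳ {n = p} D i j)
    (trans (cancel (δ i j)) (cong (_+ - + 1 * δ i j) (sym (P-ε i j))))
    where
    cancel : ∀ d → + 0 ≡ d + - + 1 * d
    cancel = solve-∀
  D-geometric (suc k) i j = begin
    (D · geometric (suc k)) i j
      ≡⟨ ·-cong {M = D} (λ _ _ → refl) (weighted-suc (λ _ → + 1) k) i j ⟩
    (D · (geometric k ⊕ + 1 ⊙ R (+ k))) i j
      ≡⟨ ·-⊕-distribˡ D (geometric k) (+ 1 ⊙ R (+ k)) i j ⟩
    (D · geometric k) i j + (D · (+ 1 ⊙ R (+ k))) i j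
      ≡⟨ cong₂ _+_ (D-geometric k i j)
           (trans (·-⊙ D (+ 1) (R (+ k)) i j) (cong (+ 1 *_) (D-R k i j))) ⟩
    R (+ k) i j + - + 1 * δ i j + + 1 * (R (+ suc k) i j + - + 1 * R (+ k) i j)
      ≡⟨ telescope (R (+ k) i j) (δ i j) (R (+ suc k) i j) ⟩
    R (+ suc k) i j + - + 1 * δ i j ∎
    where
    open ≡-Reasoning
    telescope : ∀ r d s → r + - + 1 * d + + 1 * (s + - + 1 * r) ≡ s + - + 1 * d
    telescope = solve-∀

  -- The sum of l x^l over l < k. Its product with x - 1 is k x^k - x(1 + ⋯ + x^(k-1)), which for k
  -- = p is p - Φ with Φ = 1 + ⋯ + x^(p-1): an inverse of x - 1 up to the factor p and modulo Φ.
  arithmetic : ℕ → Matrix p p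
  arithmetic = weighted (λ k → + k)

  D-arithmetic : ∀ k → D · arithmetic k ≈ + k ⊙ R (+ k) ⊕ - + 1 ⊙ (R (+ 1) · geometric k)
  D-arithmetic zero    i j = trans (·-zeroʳ {n = p} D i j)
    (sym (trans (cong (λ z → + 0 * R (+ 0) i j + - + 1 * z) (·-zeroʳ {n = p} (R (+ 1)) i j))
                (vanish (R (+ 0) i j))))
    where
    vanish : ∀ r → + 0 * r + - + 1 * + 0 ≡ + 0
    vanish = solve-∀
  D-arithmetic (suc k) i j = begin
    (D · arithmetic (suc k)) i j
      ≡⟨ ·-cong {M = D} (λ _ _ → refl) (weighted-suc (λ n → + n) k) i j ⟩
    (D · (arithmetic k ⊕ + k ⊙ R (+ k))) i j
      ≡⟨ ·-⊕-distribˡ D (arithmetic k) (+ k ⊙ R (+ k)) i j ⟩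
    (D · arithmetic k) i j + (D · (+ k ⊙ R (+ k))) i j
      ≡⟨ cong₂ _+_ (D-arithmetic k i j)
           (trans (·-⊙ D (+ k) (R (+ k)) i j) (cong (+ k *_) (D-R k i j))) ⟩
    + k * r + - + 1 * t + + k * (s + - + 1 * r)
      ≡⟨ telescope (+ k) r s t ⟩
    (+ 1 + + k) * s + - + 1 * (t + s)
      ≡⟨ cong (λ z → + suc k * s + - + 1 * z) shift ⟨
    + suc k * s + - + 1 * (R (+ 1) · geometric (suc k)) i j ∎
    where
    open ≡-Reasoning
    r = R (+ k) i j
    s = R (+ suc k) i j
    t = (R (+ 1) · geometric k) i j
    telescope : ∀ k r s t → k * r + - + 1 * t + k * (s + - + 1 * r) ≡ (+ 1 + k) * s + - + 1 * (t + s)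
    telescope = solve-∀
    shift : (R (+ 1) · geometric (suc k)) i j ≡ t + s
    shift = begin
      (R (+ 1) · geometric (suc k)) i j
        ≡⟨ ·-cong {M = R (+ 1)} (λ _ _ → refl) (weighted-suc (λ _ → + 1) k) i j ⟩
      (R (+ 1) · (geometric k ⊕ + 1 ⊙ R (+ k))) i j
        ≡⟨ ·-⊕-distribˡ (R (+ 1)) (geometric k) (+ 1 ⊙ R (+ k)) i j ⟩
      t + (R (+ 1) · (+ 1 ⊙ R (+ k))) i j
        ≡⟨ cong (_+_ t) (trans (·-⊙ (R (+ 1)) (+ 1) (R (+ k)) i j)
             (trans (ℤ.*-identityˡ _) (R-+ (+ 1) (+ k) i j))) ⟩
      t + s ∎

  geometric-p : geometric p ≈ J
  geometric-p i j = trans (sum-cong-≗ {p} λ l → cong (λ g → + 1 * P g i j) (modP-ι p l))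
    (sym (decompose J-invariant i j))

  -- Since x - 1 has row sum zero it is singular and cannot be cancelled; adding `J` moves that
  -- eigenvalue to p.
  V : Matrix p p
  V = D ⊕ J

  V-rowSum : RowSum (+ p) V
  V-rowSum = RowSum-⊕ {X = D} {J} D-rowSum RowSum-J

  V-inverse : ∃ λ H → V · H ≈ scalar (+ p * + p)
  -- With τ the coefficient sum of T, the product V T is p - Φ + τΦ, where Φ corresponds to `J`, and
  -- VΦ = pΦ. The coefficient 1 - τ is what cancels the multiples of Φ in p V T + (1 - τ) VΦ,
  -- leaving p².
  V-inverse = + p ⊙ T ⊕ (+ 1 - τ) ⊙ J , λ i j → begin
    (V · (+ p ⊙ T ⊕ (+ 1 - τ) ⊙ J)) i j
      ≡⟨ ·-⊕-distribˡ V (+ p ⊙ T) ((+ 1 - τ) ⊙ J) i j ⟩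
    (V · (+ p ⊙ T)) i j + (V · ((+ 1 - τ) ⊙ J)) i j
      ≡⟨ cong₂ _+_ (trans (·-⊙ V (+ p) T i j) (cong (+ p *_) (VT i j)))
           (trans (·-⊙ V (+ 1 - τ) J i j) (cong ((+ 1 - τ) *_) (·-J {X = V} V-rowSum i j))) ⟩
    + p * (+ p * δ i j + - + 1 * + 1 + τ * + 1) + (+ 1 - τ) * (+ p * + 1)
      ≡⟨ collect (+ p) (δ i j) τ ⟩
    + p * + p * δ i j ∎
    where
    open ≡-Reasoning
    T = arithmetic p
    T-invariant = weighted-invariant (λ k → + k) p
    τ = sum λ g → T g (modP p (+ 0))
    collect : ∀ p d t → p * (p * d + - + 1 * + 1 + t * + 1) + (+ 1 - t) * (p * + 1) ≡ p * p * d
    collect = solve-∀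
    VT : ∀ i j → (V · T) i j ≡ + p * δ i j + - + 1 * + 1 + τ * + 1
    VT i j = trans (·-⊕-distribʳ T D J i j) (cong₂ _+_
      (trans (D-arithmetic p i j) (cong₂ (λ x y → + p * x + - + 1 * y) (R-p i j)
        (trans (·-cong {M = R (+ 1)} (λ _ _ → refl) geometric-p i j)
               (·-J {X = R (+ 1)} (P-rowSum (modP p (+ 1))) i j))))
      (trans (commute J-invariant T-invariant i j) (·-J {X = T} (rowSum T-invariant) i j)))

  -- By `V-inverse` the determinant of `V` divides that of the scalar p², which is a power of a
  -- nonzero number.
  det-V-nonZero : ℤ.NonZero (det V)
  det-V-nonZero = ℤ.≢-nonZero λ detV≡0 → ℕ.NonZero.nonZero (subst ℤ.NonZero (zero-power detV≡0)
    (^-nonZero (+ p * + p) p {{ℤ.i*j≢0 (+ p) (+ p)}}))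
    where
    open ≡-Reasoning
    zero-power : det V ≡ + 0 → (+ p * + p) ^ p ≡ + 0
    zero-power detV≡0 = begin
      (+ p * + p) ^ p                ≡⟨ det-scalar p (+ p * + p) ⟨
      det (scalar {p} (+ p * + p))   ≡⟨ det-cong (proj₂ V-inverse) ⟨
      det (V · proj₁ V-inverse)      ≡⟨ det-· V (proj₁ V-inverse) ⟩
      det V * det (proj₁ V-inverse)  ≡⟨ cong (_* det (proj₁ V-inverse)) detV≡0 ⟩
      + 0 * det (proj₁ V-inverse)    ≡⟨ ℤ.*-zeroˡ (det (proj₁ V-inverse)) ⟩
      + 0                            ∎

  module _ (pp : Prime p) (a : ℕ) (p∤a : ¬ p ∣ a) where

    -- Multiplication by `a` on residues, the automorphism of the cyclic group that carries x to
    -- x^a.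
    σ : Fin p → Fin p
    σ i = modP p (+ a * ι i)

    σ-modP : ∀ z → σ (modP p z) ≡ modP p (+ a * z)
    σ-modP z = let k , h = ι-modP p z in
      modP-cong p _ (+ a * z) (+ a * k) (trans (cong (+ a *_) h) (regroup (+ a) z k (+ p)))
      where
      regroup : ∀ a z k p → a * (z + k * p) ≡ a * z + a * k * p
      regroup = solve-∀

    σ-injective : ∀ {i j} → σ i ≡ σ j → i ≡ j
    σ-injective {i} {j} h with ι-modP p (+ a * ι i) | ι-modP p (+ a * ι j)
    ... | k , hk | l , hl = divisible (euclidsLemma a ∣ ι i - ι j ∣ pp
        (subst (p ∣_) (ℤ.abs-* (+ a) (ι i - ι j)) (ℕ.divides ∣ l - k ∣
          (trans (cong ∣_∣ product) (ℤ.abs-* (l - k) (+ p))))))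
      where
      open ≡-Reasoning
      regroup₁ : ∀ a x y k p → a * (x - y) ≡ a * x + k * p - k * p - a * y
      regroup₁ = solve-∀
      regroup₂ : ∀ y k l p → y + l * p - k * p - y ≡ (l - k) * p
      regroup₂ = solve-∀
      regroup₃ : ∀ x y → x ≡ y + (x - y)
      regroup₃ = solve-∀
      product : + a * (ι i - ι j) ≡ (l - k) * + p
      product = begin
        + a * (ι i - ι j)                                    ≡⟨ regroup₁ (+ a) (ι i) (ι j) k (+ p) ⟩
        + a * ι i + k * + p - k * + p - + a * ι j            ≡⟨ cong (λ z → z - k * + p - + a * ι j) hk ⟨
        ι (σ i) - k * + p - + a * ι j                        ≡⟨ cong (λ g → ι g - k * + p - + a * ι j) h ⟩
        ι (σ j) - k * + p - + a * ι j                        ≡⟨ cong (λ z → z - k * + p - + a * ι j) hl ⟩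
        + a * ι j + l * + p - k * + p - + a * ι j            ≡⟨ regroup₂ (+ a * ι j) k l (+ p) ⟩
        (l - k) * + p                                        ∎
      divisible : (p ∣ a) ⊎ (p ∣ ∣ ι i - ι j ∣) → i ≡ j
      divisible (inj₁ p∣a) = contradiction p∣a p∤a
      divisible (inj₂ p∣d) with Signed.∣ᵤ⇒∣ {+ p} {ι i - ι j} p∣d
      ... | Signed.divides q eq = ι-congruent i j q (trans (regroup₃ (ι i) (ι j)) (cong (_+_ (ι j)) eq))

    σ-shift : ∀ j → σ (modP p (+ 1) ∙ᶻ′ j) ≡ modP p (+ a) ∙ᶻ′ σ j
    σ-shift j = begin
      σ (modP p (+ 1) ∙ᶻ′ j)                   ≡⟨ cong (λ i → σ (modP p (+ 1) ∙ᶻ′ i)) (modP-ι p j) ⟨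
      σ (modP p (+ 1) ∙ᶻ′ modP p (ι j))        ≡⟨ cong σ (modP-+ p (+ 1) (ι j)) ⟩
      σ (modP p (+ 1 + ι j))                 ≡⟨ σ-modP (+ 1 + ι j) ⟩
      modP p (+ a * (+ 1 + ι j))             ≡⟨ cong (modP p) (distrib (+ a) (ι j)) ⟩
      modP p (+ a + + a * ι j)               ≡⟨ modP-+ p (+ a) (+ a * ι j) ⟨
      modP p (+ a) ∙ᶻ′ σ j                     ∎
      where
      open ≡-Reasoning
      distrib : ∀ a x → a * (+ 1 + x) ≡ a + a * x
      distrib = solve-∀

    -- V(x) = x − 1 + Φ with Φ = 1 + ⋯ + x^(p-1): multiplied by 1 + ⋯ + x^(a-1) it becomes
    -- x^a − 1 + aΦ, which is conjugate to x − 1 + aΦ by the relabelling σ.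
    geometric-V : geometric a · V ≈ R (+ a) ⊕ - + 1 ⊙ δ ⊕ + a ⊙ J
    geometric-V = ≈-trans (·-⊕-distribˡ (geometric a) D J) (⊕-cong
      (≈-trans (commute (weighted-invariant (λ _ → + 1) a) D-invariant) (D-geometric a))
      (·-J {X = geometric a} (geometric-rowSum a)))

    relabelled : ∀ i j → (R (+ a) ⊕ - + 1 ⊙ δ ⊕ + a ⊙ J) (σ i) (σ j) ≡ (V ⊕ (+ a - + 1) ⊙ J) i j
    relabelled i j = trans
      (cong₂ (λ x y → x + - + 1 * y + + a * + 1)
        (trans (cong (δ (σ i)) (sym (σ-shift j))) (δ-cong-⇔ σ-injective (cong σ)))
        (δ-cong-⇔ σ-injective (cong σ)))
      (regroup (R (+ 1) i j) (δ i j) (+ a))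
      where
      regroup : ∀ r d a → r + - + 1 * d + a * + 1 ≡ r + - + 1 * d + + 1 + (a - + 1) * + 1
      regroup = solve-∀

    -- Take determinants in `geometric-V`. After relabelling, the right side is `V` plus a - 1 times
    -- `J`; as `V` has row sum p, `det-⊕-J` evaluates this to a times det V, up to the common factor
    -- p. Then det V · p is cancelled.
    det-geometric : det (geometric a) ≡ + a
    det-geometric = ℤ.*-cancelʳ-≡ _ _ (det V * + p) {{nonZero}} (begin
      det (geometric a) * (det V * + p)   ≡⟨ ℤ.*-assoc (det (geometric a)) (det V) (+ p) ⟨
      det (geometric a) * det V * + p     ≡⟨ cong (_* + p) (det-· (geometric a) V) ⟨
      det (geometric a · V) * + p         ≡⟨ cong (_* + p) (det-cong geometric-V) ⟩
      det (R (+ a) ⊕ - + 1 ⊙ δ ⊕ + a ⊙ J) * + p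
        ≡⟨ cong (_* + p) (det-relabel σ-injective (R (+ a) ⊕ - + 1 ⊙ δ ⊕ + a ⊙ J)) ⟨
      det (λ i j → (R (+ a) ⊕ - + 1 ⊙ δ ⊕ + a ⊙ J) (σ i) (σ j)) * + p
        ≡⟨ cong (_* + p) (det-cong relabelled) ⟩
      det (V ⊕ (+ a - + 1) ⊙ J) * + p     ≡⟨ det-⊕-J (+ p) (+ a - + 1) V V-rowSum ⟩
      det V * (+ p + + p * (+ a - + 1))   ≡⟨ collect (det V) (+ p) (+ a) ⟩
      + a * (det V * + p)                 ∎)
      where
      open ≡-Reasoning
      collect : ∀ v p a → v * (p + p * (a - + 1)) ≡ a * (v * p)
      collect = solve-∀
      nonZero : ℤ.NonZero (det V * + p)
      nonZero = ℤ.i*j≢0 (det V) (+ p) {{det-V-nonZero}}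

-- The Heisenberg group

-- Summing over one fiber replaces `C` by its row sum and the all-ones block by p, which leaves a
-- row of `scalar a ⊕ + p ⊙ B`.
RowSum-fibered : ∀ {n p a t} {B : Matrix n n} {C : Matrix p p} → RowSum a C → RowSum t (scalar a ⊕ + p ⊙ B) →
                 RowSum t (fibered B C)
RowSum-fibered {n} {p} {a} {t} {B} {C} r q i = begin
  sum (fibered B C i)
    ≡⟨ sum-remQuot n (fiberedEntry B C (remQuot {n} p i)) ⟩
  sum (λ j → sum λ l → δ u j * C v l + B u j)
    ≡⟨ sum-cong-≗ (λ j → trans (sum-linear (δ u j) (C v) (λ _ → B u j))
         (cong₂ _+_ (trans (cong (δ u j *_) (r v)) (ℤ.*-comm (δ u j) a)) (sum-constant p (B u j)))) ⟩
  sum (λ j → a * δ u j + + p * B u j)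
    ≡⟨ q u ⟩
  t ∎
  where
  open ≡-Reasoning
  u = proj₁ (remQuot {n} p i)
  v = proj₂ (remQuot {n} p i)

-- F = u(z) + Φ(z) h(x, y) with Φ(z) = 1 + z + ⋯ + z^(p-1), where u and h are the functions
-- generating the invariant matrices C and B.
module HeisenbergDeterminant (p : ℕ) .{{_ : NonZero p}} where

  open Cyclic p using () renaming (Invariant to Cyclic-Invariant; invariant-ratio to cyclic-ratio)
  open ProductGroup (cyclic-isAbelianGroup p) (cyclic-isAbelianGroup p)
  open IsAbelianGroup (cyclic-isAbelianGroup p) using () renaming (identityʳ to cyclic-identityʳ)

  module _ {B : Matrix (p ℕ.* p) (p ℕ.* p)} {C : Matrix p p}
           (B-invariant : Product.Invariant B) (C-invariant : Cyclic-Invariant C) where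

    coefficients : Fin p → Fin p → Fin p → ℤ
    coefficients x y z = δ (combine x y) ε * C z (modP p (+ 0)) + B (combine x y) ε

    groupDet-coefficients : groupDet p coefficients ≡ det (fibered B C)
    groupDet-coefficients = det-cong λ i j →
      entry (proj₁ (remQuot {p ℕ.* p} p i)) (proj₂ (remQuot {p ℕ.* p} p i))
            (proj₁ (remQuot {p ℕ.* p} p j)) (proj₂ (remQuot {p ℕ.* p} p j))
      where
      open ≡-Reasoning
      -- The central coordinate of g h⁻¹ for g = (u, k) and h = (v, l), exactly as `mulH` and `invH`
      -- compute it.
      third : Fin (p ℕ.* p) → Fin p → Fin (p ℕ.* p) → Fin p → Fin p
      third u k v l = modP p (ι k + ι (modP p (ι (fst v) * ι (snd v) - ι l)) + ι (snd u) * ι (modP p (- ι (fst v))))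

      -- Inversion contributes ab and multiplication contributes b(-a), so over equal noncentral
      -- parts the twist cancels and k - l remains.
      third-diagonal : ∀ u k l → _∙ᶻ_ p (third u k u l) l ≡ k
      third-diagonal u k l with ι-modP p (ι (fst u) * ι (snd u) - ι l) | ι-modP p (- ι (fst u))
      ... | s , hs | t , ht = begin
        _∙ᶻ_ p (third u k u l) l                ≡⟨ cong (_∙ᶻ_ p (third u k u l)) (modP-ι p l) ⟨
        _∙ᶻ_ p (modP p z) (modP p (ι l))        ≡⟨ modP-+ p z (ι l) ⟩
        modP p (z + ι l)                        ≡⟨ modP-≡ p (z + ι l) k (s + ι (snd u) * t) collected ⟩
        k                                       ∎
        where
        z = ι k + ι (modP p (ι (fst u) * ι (snd u) - ι l)) + ι (snd u) * ι (modP p (- ι (fst u)))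
        collect : ∀ a b k l s t p → k + (a * b - l + s * p) + b * (- a + t * p) + l ≡ k + (s + b * t) * p
        collect = solve-∀
        collected : z + ι l ≡ ι k + (s + ι (snd u) * t) * + p
        collected = trans (cong₂ (λ x y → ι k + x + ι (snd u) * y + ι l) hs ht)
          (collect (ι (fst u)) (ι (snd u)) (ι k) (ι l) s t (+ p))

      ratio : Fin (p ℕ.* p) → Fin (p ℕ.* p) → Fin (p ℕ.* p)
      ratio u v = combine (_∙ᶻ_ p (fst u) (_⁻¹ᶻ p (fst v))) (_∙ᶻ_ p (snd u) (_⁻¹ᶻ p (snd v)))

      -- In the shape that `invariant-ratio` needs to turn the coefficient at u/v into the matrix
      -- entry at (u, v).
      ratio-∙ : ∀ u v → u ∙ ε ≡ ratio u v ∙ v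
      ratio-∙ u v = sym (begin
        ratio u v ∙ v    ≡⟨ cong (_∙ v) (cong₂ (λ x y → combine (_∙ᶻ_ p (fst u) x) (_∙ᶻ_ p (snd u) y))
                              (fst-combine _ (_⁻¹ᶻ p (snd v))) (snd-combine (_⁻¹ᶻ p (fst v)) _)) ⟨
        (u ∙ (v ⁻¹)) ∙ v ≡⟨ IsAbelianGroup.assoc product-isAbelianGroup u (v ⁻¹) v ⟩
        u ∙ ((v ⁻¹) ∙ v) ≡⟨ cong (u ∙_) (IsAbelianGroup.inverseˡ product-isAbelianGroup v) ⟩
        u ∙ ε            ∎)

      -- For distinct noncentral parts `δ u v` removes the twisted coordinate altogether; for equal
      -- ones the twist cancels. The summand with `B` never involves this coordinate.
      central : ∀ u k v l → δ u v * C (third u k v l) (modP p (+ 0)) ≡ δ u v * C k l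
      central u k v l with u Fin.≟ v
      ... | yes refl = cong (δ u v *_) (sym (cyclic-ratio C-invariant
                         (trans (cyclic-identityʳ k) (sym (third-diagonal u k l)))))
      ... | no u≢v = trans (cong (_* C (third u k v l) (modP p (+ 0))) (δ-≢ u≢v))
        (trans (ℤ.*-zeroˡ (C (third u k v l) (modP p (+ 0))))
          (sym (trans (cong (_* C k l) (δ-≢ u≢v)) (ℤ.*-zeroˡ (C k l)))))

      entry : ∀ u k v l → coefficients (_∙ᶻ_ p (fst u) (_⁻¹ᶻ p (fst v))) (_∙ᶻ_ p (snd u) (_⁻¹ᶻ p (snd v)))
                            (third u k v l) ≡ fiberedEntry B C (u , k) (v , l)
      entry u k v l = cong₂ _+_
        (trans (cong (_* C (third u k v l) (modP p (+ 0))) (sym (Product.invariant-ratio Product.invariant-δ (ratio-∙ u v))))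
               (central u k v l))
        (sym (Product.invariant-ratio B-invariant (ratio-∙ u v)))

-- Choice of the base matrix and evaluation of the determinant

module Construction (p : ℕ) .{{_ : NonZero p}} (pp : Prime p) (a : ℕ) (p∤a : ¬ p ∣ a) where

  open Circulant p
  open Cyclic p using () renaming (Invariant to Cyclic-Invariant; rowSum to cyclic-rowSum)
  open ProductGroup (cyclic-isAbelianGroup p) (cyclic-isAbelianGroup p)
  open ≡-Reasoning

  instance
    a-nonZero : NonZero a
    a-nonZero = ℕ.≢-nonZero λ { refl → p∤a (p ℕ.∣0) }

    aᵖ-nonZero : ℤ.NonZero ((+ a) ^ p)
    aᵖ-nonZero = ^-nonZero (+ a) p

  o : Fin p
  o = modP p (+ 0)

  C : Matrix p p
  C = geometric a

  C-invariant : Cyclic-Invariant C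
  C-invariant = weighted-invariant (λ _ → + 1) a

  C-rowSum : RowSum (+ a) C
  C-rowSum = geometric-rowSum a

  -- Since det C = a cancels the factor aⁿ of det-fibered, only the determinant on the base remains.
  det-over-C : ∀ {n} (B : Matrix n n) → det (fibered B C) ≡ det (scalar (+ a) ⊕ + p ⊙ B)
  det-over-C {n} B = ℤ.*-cancelʳ-≡ _ _ ((+ a) ^ n) {{^-nonZero (+ a) n}} (begin
    det (fibered B C) * (+ a) ^ n                   ≡⟨ det-fibered (+ a) B C C-rowSum ⟩
    det C ^ n * det (scalar (+ a) ⊕ + p ⊙ B)
      ≡⟨ cong (λ z → z ^ n * det (scalar (+ a) ⊕ + p ⊙ B)) (det-geometric pp a p∤a) ⟩
    (+ a) ^ n * det (scalar (+ a) ⊕ + p ⊙ B)        ≡⟨ ℤ.*-comm ((+ a) ^ n) _ ⟩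
    det (scalar (+ a) ⊕ + p ⊙ B) * (+ a) ^ n        ∎)

  C-power : CongruentPower p (+ a) C
  -- `frobenius` yields the sum of the coefficients, which for an invariant matrix is its row sum,
  -- here a.
  C-power = subst (λ s → CongruentPower p s C) (trans (sym (cyclic-rowSum C-invariant o)) (C-rowSum o))
    (Cyclic.frobenius p pp (cyclic-exponent p) C-invariant)

  B′ : Matrix p p
  B′ = quotient C-power

  Cᵖ : C ^ᴹ p ≈ scalar (+ a) ⊕ + p ⊙ B′
  Cᵖ = power C-power

  G : Matrix (p ℕ.* p) (p ℕ.* p)
  G = fibered B′ C

  G-invariant : Product.Invariant G
  G-invariant = fibered-invariant (Cyclic.quotient-invariant p C-invariant C-power) C-invariant

  base-rowSum : RowSum ((+ a) ^ p) (scalar (+ a) ⊕ + p ⊙ B′)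
  base-rowSum = RowSum-cong {X = C ^ᴹ p} Cᵖ (RowSum-^ᴹ {X = C} C-rowSum p)

  G-rowSum : RowSum ((+ a) ^ p) G
  G-rowSum = RowSum-fibered {B = B′} {C} C-rowSum base-rowSum

  det-G : det G ≡ (+ a) ^ p
  det-G = begin
    det G                            ≡⟨ det-over-C B′ ⟩
    det (scalar (+ a) ⊕ + p ⊙ B′)    ≡⟨ det-cong Cᵖ ⟨
    det (C ^ᴹ p)                     ≡⟨ det-^ᴹ C p ⟩
    det C ^ p                        ≡⟨ cong (_^ p) (det-geometric pp a p∤a) ⟩
    (+ a) ^ p                        ∎

  product-exponent : ∀ g → Product.pow g p ≡ ε
  product-exponent g = trans (product-pow g p) (cong₂ combine (cyclic-exponent p (fst g)) (cyclic-exponent p (snd g)))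

  G-power : CongruentPower p ((+ a) ^ p) G
  G-power = subst (λ s → CongruentPower p s G) (trans (sym (Product.rowSum G-invariant ε)) (G-rowSum ε))
    (Product.frobenius pp product-exponent G-invariant)

  t : ℤ
  t = sum (B′ o)

  -- Comparing row sums in C^p = aI + pB′ exhibits the Fermat quotient (a^p - a)/p as the row sum
  -- `t` of `B′`.
  fermat : (+ a) ^ p ≡ + a + + p * t
  fermat = trans (sym (base-rowSum o)) (trans (sum-linear (+ a) (δ o) (λ j → + p * B′ o j))
    (cong₂ _+_ (trans (cong (+ a *_) (RowSum-δ o)) (ℤ.*-identityʳ (+ a))) (sym (*-distribˡ-sum (+ p) (B′ o)))))

  module _ (m : ℤ) where

    -- The congruence for `G` has the scalar a^p where a is wanted; `scalar t` absorbs the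
    -- difference p t. The multiple of `J` carries the free parameter.
    B : Matrix (p ℕ.* p) (p ℕ.* p)
    B = scalar t ⊕ quotient G-power ⊕ m ⊙ J

    B-invariant : Product.Invariant B
    B-invariant = Product.invariant-⊕
      (Product.invariant-⊕ (Product.invariant-⊙ t Product.invariant-δ) (Product.quotient-invariant G-invariant G-power))
      (λ _ _ _ → refl)

    Gᵖ : scalar (+ a) ⊕ + p ⊙ B ≈ G ^ᴹ p ⊕ (+ p * m) ⊙ J
    Gᵖ i j = sym (trans
      (cong (_+ + p * m * + 1) (trans (power G-power i j) (cong (λ z → z * δ i j + + p * quotient G-power i j) fermat)))
      (collect (+ a) (+ p) t m (δ i j) (quotient G-power i j)))
      where
      collect : ∀ a p t m d q → (a + p * t) * d + p * q + p * m * + 1 ≡ a * d + p * (t * d + q + m * + 1)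
      collect = solve-∀

    det-fibered-B : det (fibered B C) ≡ (+ a) ^ (p ℕ.* p) + m * + (p ℕ.^ 3)
    det-fibered-B = ℤ.*-cancelʳ-≡ _ _ s {{^-nonZero ((+ a) ^ p) p}} (begin
      det (fibered B C) * s                   ≡⟨ cong (_* s) (trans (det-over-C B) (det-cong Gᵖ)) ⟩
      -- On p² points the multiple pm of `J` adds p² · pm to the row sum. The determinant of
      -- `G ^ᴹ p` is the same `s` as its row sum, so the factor `s` cancels on both sides.
      det (G ^ᴹ p ⊕ (+ p * m) ⊙ J) * s        ≡⟨ det-⊕-J s (+ p * m) (G ^ᴹ p) (RowSum-^ᴹ {X = G} G-rowSum p) ⟩
      det (G ^ᴹ p) * (s + + (p ℕ.* p) * (+ p * m))
        ≡⟨ cong (_* (s + + (p ℕ.* p) * (+ p * m))) (trans (det-^ᴹ G p) (cong (_^ p) det-G)) ⟩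
      s * (s + + (p ℕ.* p) * (+ p * m))
        ≡⟨ trans (cong (λ z → s * (s + z)) cube) (ℤ.*-comm s _) ⟩
      (s + m * + (p ℕ.^ 3)) * s
        ≡⟨ cong (λ z → (z + m * + (p ℕ.^ 3)) * s) (ℤ.^-*-assoc (+ a) p p) ⟩
      ((+ a) ^ (p ℕ.* p) + m * + (p ℕ.^ 3)) * s ∎)
      where
      s = ((+ a) ^ p) ^ p
      regroup : ∀ p m → p * p * (p * m) ≡ m * (p * (p * (p * + 1)))
      regroup = solve-∀
      cube : + (p ℕ.* p) * (+ p * m) ≡ m * + (p ℕ.^ 3)
      cube = begin
        + (p ℕ.* p) * (+ p * m)           ≡⟨ cong (_* (+ p * m)) (ℤ.pos-* p p) ⟩
        + p * + p * (+ p * m)             ≡⟨ regroup (+ p) m ⟩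
        m * (+ p * (+ p * (+ p * + 1)))
          ≡⟨ cong (m *_) (trans (ℤ.pos-* p (p ℕ.* (p ℕ.* 1))) (cong (+ p *_)
               (trans (ℤ.pos-* p (p ℕ.* 1)) (cong (+ p *_) (ℤ.pos-* p 1))))) ⟨
        m * + (p ℕ.^ 3)                   ∎

theorem3 : (p : ℕ) .{{_ : NonZero p}} → Prime p → 3 ≤ p →
           (a : ℕ) → ¬ (p ∣ a) → (m : ℤ) →
           Σ (Fin p → Fin p → Fin p → ℤ) λ F →
             groupDet p F ≡ (+ a) ^ (p ℕ.* p) + m * + (p ℕ.^ 3)
theorem3 p pp _ a p∤a m = coefficients (B-invariant m) C-invariant ,
  trans (groupDet-coefficients (B-invariant m) C-invariant) (det-fibered-B m)
  where
  open Construction p pp a p∤a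
  open HeisenbergDeterminant p
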